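{- Let $0<\alpha<10^{ -5}$ and let $G$ be a graph with $n$ vertices and $m$ edges, where $m\ge\left(\frac14-\alpha\right)n^2$. Then either \[ bk(G)>\left(\frac16-2\alpha^{1/3}\right)n, \] or $G$ contains an induced bipartite subgraph $G_1$ with at least $\left(1-\alpha^{1/3}\right)n$ vertices and minimum degree \[ \delta(G_1)\ge\left(\frac12-4\alpha^{1/3}\right)n. \]
   Context: A book of size $q$ is a set of $q$ triangles sharing a common edge; the booksize $bk(G)$ is the size of the largest book in $G$, i.e. the maximum over edges $uv$ of the number of common neighbours of $u$ and $v$. $\delta(H)$ is the minimum degree of a graph $H$. -}

module Defs where

open import Data.Empty using (⊥)
open import Data.Fin.Base using (Fin)
import Data.Fin.Properties as Fin
open import Data.Fin.Subset using (Subset; _∈_; _∉_; _∩_; _∪_; ∣_∣; Empty)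
open import Data.Fin.Subset.Properties using (_∈?_)
open import Data.Integer.Base using (+_)
open import Data.List.Base
  using (List; []; _∷_; map; filter; length; allFin; cartesianProduct)
open import Data.List.Extrema.Nat using (max; min)
open import Data.Nat.Base as ℕ using (ℕ; zero; suc)
open import Data.Product.Base using (_×_; _,_; ∃; ∃₂; proj₁; proj₂)
open import Data.Rational.Base as ℚ
  using (ℚ; 0ℚ; 1ℚ; Positive; NonNegative; positive; nonNegative; _/_; 1/_)
import Data.Rational.Properties as ℚ
open import Data.Rational.Solver using (module +-*-Solver)
open import Data.Sum.Base using (_⊎_; inj₁; inj₂; swap)
open import Relation.Binary.PropositionalEquality
  using (_≡_; refl; sym; trans; cong; cong₂; subst; subst₂)
open import Relation.Nullary using (yes; no)
open import Relation.Nullary.Decidable using (_×-dec_)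

------------------------------------------------------------------------
-- Finite simple graphs

record Graph (n : ℕ) : Set where
  field
    N        : Fin n → Subset n
    N-sym    : ∀ {u v} → v ∈ N u → u ∈ N v
    N-irrefl : ∀ {u} → u ∉ N u

open Graph public

edges : ∀ {n} → Graph n → List (Fin n × Fin n)
edges {n} G =
  filter (λ (u , v) → (u Fin.<? v) ×-dec (v ∈? N G u))
         (cartesianProduct (allFin n) (allFin n))

∣E∣ : ∀ {n} → Graph n → ℕ
∣E∣ G = length (edges G)

-- The triangles on an edge uv correspond to the common neighbours of u and v.
-- A graph without edges has booksize 0.
bk : ∀ {n} → Graph n → ℕ
bk G = max 0 (map (λ (u , v) → ∣ N G u ∩ N G v ∣) (edges G))

-- Induced subgraphs of G are given by their vertex sets S.

-- The minimum degree of G[S]; it is 0 when S is empty.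
δ : ∀ {n} → Graph n → Subset n → ℕ
δ {n} G S = minimum (map (λ u → ∣ N G u ∩ S ∣) (filter (_∈? S) (allFin n)))
  where
  minimum : List ℕ → ℕ
  minimum []       = 0
  minimum (d ∷ ds) = min d ds

Independent : ∀ {n} → Graph n → Subset n → Set
Independent G A = ∀ {u v} → u ∈ A → v ∈ A → v ∉ N G u

-- G[S] is bipartite.
Bipartite : ∀ {n} → Graph n → Subset n → Set
Bipartite G S = ∃₂ λ A B →
  A ∪ B ≡ S × Empty (A ∩ B) × Independent G A × Independent G B

------------------------------------------------------------------------
-- Real numbers, as two-sided Dedekind cuts

record ℝ : Set₁ where
  field
    L U       : ℚ → Set
    L-inhab   : ∃ L
    U-inhab   : ∃ U
    L-down    : ∀ {q r} → q ℚ.< r → L r → L q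
    U-up      : ∀ {q r} → q ℚ.< r → U q → U r
    L-open    : ∀ {q} → L q → ∃ λ r → q ℚ.< r × L r
    U-open    : ∀ {r} → U r → ∃ λ q → q ℚ.< r × U q
    disjoint  : ∀ {q} → L q → U q → ⊥
    located   : ∀ {q r} → q ℚ.< r → L q ⊎ U r

open ℝ public

infix 4 _<_ _≤_ _>_ _≥_

_<_ _≤_ _>_ _≥_ : ℝ → ℝ → Set
x < y = ∃ λ q → U x q × L y q
x ≤ y = ∀ q → L x q → L y q
x > y = y < x
x ≥ y = y ≤ x

0<-⇒< : ∀ {p q} → 0ℚ ℚ.< q ℚ.- p → p ℚ.< q
0<-⇒< {p} {q} h = subst₂ ℚ._<_ (ℚ.+-identityˡ p)
  (solve 2 (λ a b → (b :- a) :+ a := b) refl p q) (ℚ.+-monoˡ-< p h)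
  where open +-*-Solver

<⇒0<- : ∀ {p q} → p ℚ.< q → 0ℚ ℚ.< q ℚ.- p
<⇒0<- {p} {q} h = subst (ℚ._< q ℚ.- p) (ℚ.+-inverseʳ p)
  (ℚ.+-monoˡ-< (ℚ.- p) h)

p-1<p : ∀ p → p ℚ.- 1ℚ ℚ.< p
p-1<p p = subst (p ℚ.- 1ℚ ℚ.<_) (ℚ.+-identityʳ p)
  (ℚ.+-monoʳ-< p (ℚ.negative⁻¹ (ℚ.- 1ℚ)))

p<p+1 : ∀ p → p ℚ.< p ℚ.+ 1ℚ
p<p+1 p = subst (ℚ._< p ℚ.+ 1ℚ) (ℚ.+-identityʳ p)
  (ℚ.+-monoʳ-< p (ℚ.positive⁻¹ 1ℚ))

fromℚ : ℚ → ℝ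
fromℚ p = record
  { L        = ℚ._< p
  ; U        = p ℚ.<_
  ; L-inhab  = _ , p-1<p p
  ; U-inhab  = _ , p<p+1 p
  ; L-down   = ℚ.<-trans
  ; U-up     = λ q<r p<q → ℚ.<-trans p<q q<r
  ; L-open   = ℚ.<-dense
  ; U-open   = λ p<r → let q , p<q , q<r = ℚ.<-dense p<r in q , q<r , p<q
  ; disjoint = ℚ.<-asym
  ; located  = located′
  }
  where
  located′ : ∀ {q r} → q ℚ.< r → q ℚ.< p ⊎ p ℚ.< r
  located′ {q} {r} q<r with q ℚ.<? p
  ... | yes q<p = inj₁ q<p
  ... | no  q≮p = inj₂ (ℚ.≤-<-trans (ℚ.≮⇒≥ q≮p) q<r)

fromℕ : ℕ → ℝ
fromℕ k = fromℚ (+ k / 1)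

infixl 6 _⊖_
infixr 7 _⋆_

p-[p-q] : ∀ p q → p ℚ.- (p ℚ.- q) ≡ q
p-[p-q] = solve 2 (λ p q → p :- (p :- q) := q) refl
  where open +-*-Solver

-ʳ-anti : ∀ p {q r} → q ℚ.< r → p ℚ.- r ℚ.< p ℚ.- q
-ʳ-anti p q<r = ℚ.+-monoʳ-< p (ℚ.neg-antimono-< q<r)

-- The difference of a rational and a real.
_⊖_ : ℚ → ℝ → ℝ
p ⊖ x = record
  { L        = λ q → U x (p ℚ.- q)
  ; U        = λ q → L x (p ℚ.- q)
  ; L-inhab  = let q , Uq = U-inhab x in
               p ℚ.- q , subst (U x) (sym (p-[p-q] p q)) Uq
  ; U-inhab  = let q , Lq = L-inhab x in
               p ℚ.- q , subst (L x) (sym (p-[p-q] p q)) Lq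
  ; L-down   = λ q<r → U-up x (-ʳ-anti p q<r)
  ; U-up     = λ q<r → L-down x (-ʳ-anti p q<r)
  ; L-open   = λ {q} Uq → let s , s<p-q , Us = U-open x Uq in
               p ℚ.- s
               , subst (ℚ._< p ℚ.- s) (p-[p-q] p q) (-ʳ-anti p s<p-q)
               , subst (U x) (sym (p-[p-q] p s)) Us
  ; U-open   = λ {r} Lr → let s , p-r<s , Ls = L-open x Lr in
               p ℚ.- s
               , subst (p ℚ.- s ℚ.<_) (p-[p-q] p r) (-ʳ-anti p p-r<s)
               , subst (L x) (sym (p-[p-q] p s)) Ls
  ; disjoint = λ Uq Lq → disjoint x Lq Uq
  ; located  = λ q<r → swap (located x (-ʳ-anti p q<r))
  }

-- The cut q ↦ f q of a real x, i.e. f⁻¹(x), for f an increasing,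
-- unbounded and continuous function on ℚ.
pullback : (f : ℚ → ℚ) →
           (∀ {q r} → q ℚ.< r → f q ℚ.< f r) →
           (∀ p → ∃ λ q → f q ℚ.< p) →
           (∀ p → ∃ λ q → p ℚ.< f q) →
           (∀ {q p} → f q ℚ.< p → ∃ λ r → q ℚ.< r × f r ℚ.< p) →
           (∀ {r p} → p ℚ.< f r → ∃ λ q → q ℚ.< r × p ℚ.< f q) →
           ℝ → ℝ
pullback f mono below above right left x = record
  { L        = λ q → L x (f q)
  ; U        = λ q → U x (f q)
  ; L-inhab  = let p , Lp = L-inhab x ; q , fq<p = below p in
               q , L-down x fq<p Lp
  ; U-inhab  = let p , Up = U-inhab x ; q , p<fq = above p in
               q , U-up x p<fq Up
  ; L-down   = λ q<r → L-down x (mono q<r)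
  ; U-up     = λ q<r → U-up x (mono q<r)
  ; L-open   = λ Lfq → let p , fq<p , Lp = L-open x Lfq
                           r , q<r , fr<p = right fq<p in
               r , q<r , L-down x fr<p Lp
  ; U-open   = λ Ufr → let p , p<fr , Up = U-open x Ufr
                           q , q<r , p<fq = left p<fr in
               q , q<r , U-up x p<fq Up
  ; disjoint = disjoint x
  ; located  = λ q<r → located x (mono q<r)
  }

module Scale (k : ℕ) where

  K : ℚ
  K = + suc k / 1

  instance
    K>0 : Positive K
    K>0 = ℚ.normalize-pos (suc k) 1
    K≢0 : ℚ.NonZero K
    K≢0 = ℚ.pos⇒nonZero K

  1/K : ℚ
  1/K = 1/ K

  instance
    1/K>0 : Positive 1/K
    1/K>0 = ℚ.1/pos⇒pos K

  f : ℚ → ℚ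
  f q = q ℚ.* 1/K

  f[p*K] : ∀ p → f (p ℚ.* K) ≡ p
  f[p*K] p = trans (ℚ.*-assoc p K 1/K)
    (trans (cong (p ℚ.*_) (ℚ.*-inverseʳ K)) (ℚ.*-identityʳ p))

  f[p]*K : ∀ p → f p ℚ.* K ≡ p
  f[p]*K p = trans (ℚ.*-assoc p 1/K K)
    (trans (cong (p ℚ.*_) (ℚ.*-inverseˡ K)) (ℚ.*-identityʳ p))

  below : ∀ p → ∃ λ q → f q ℚ.< p
  below p = (p ℚ.- 1ℚ) ℚ.* K , subst (ℚ._< p) (sym (f[p*K] _)) (p-1<p p)

  above : ∀ p → ∃ λ q → p ℚ.< f q
  above p = (p ℚ.+ 1ℚ) ℚ.* K , subst (p ℚ.<_) (sym (f[p*K] _)) (p<p+1 p)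

  right : ∀ {q p} → f q ℚ.< p → ∃ λ r → q ℚ.< r × f r ℚ.< p
  right {q} {p} h = let s , fq<s , s<p = ℚ.<-dense h in
    s ℚ.* K
    , subst (ℚ._< s ℚ.* K) (f[p]*K q) (ℚ.*-monoˡ-<-pos K fq<s)
    , subst (ℚ._< p) (sym (f[p*K] s)) s<p

  left : ∀ {r p} → p ℚ.< f r → ∃ λ q → q ℚ.< r × p ℚ.< f q
  left {r} {p} h = let s , p<s , s<fr = ℚ.<-dense h in
    s ℚ.* K
    , subst (s ℚ.* K ℚ.<_) (f[p]*K r) (ℚ.*-monoˡ-<-pos K s<fr)
    , subst (p ℚ.<_) (sym (f[p*K] s)) p<s

-- Natural multiples: for n > 0, q < n x iff q / n < x.
_⋆_ : ℕ → ℝ → ℝ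
zero  ⋆ x = fromℚ 0ℚ
suc k ⋆ x =
  pullback f (ℚ.*-monoˡ-<-pos 1/K) below above right left x
  where open Scale k

cube : ℚ → ℚ
cube q = q ℚ.* q ℚ.* q

module Cube where

  open +-*-Solver

  cube-neg : ∀ q → cube (ℚ.- q) ≡ ℚ.- cube q
  cube-neg = solve 1 (λ q → (:- q) :* (:- q) :* (:- q) := :- (q :* q :* q)) refl

  neg-neg : ∀ q → ℚ.- (ℚ.- q) ≡ q
  neg-neg = solve 1 (λ q → :- (:- q) := q) refl

  q≤∣q∣ : ∀ q → q ℚ.≤ ℚ.∣ q ∣
  q≤∣q∣ q with ℚ.≤-total 0ℚ q
  ... | inj₁ 0≤q = ℚ.≤-reflexive (sym (ℚ.0≤p⇒∣p∣≡p 0≤q))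
  ... | inj₂ q≤0 = ℚ.≤-trans q≤0 (ℚ.0≤∣p∣ q)

  ∣q∣² : ∀ q → ℚ.∣ q ∣ ℚ.* ℚ.∣ q ∣ ≡ q ℚ.* q
  ∣q∣² q with ℚ.∣p∣≡p∨∣p∣≡-p q
  ... | inj₁ e = cong₂ ℚ._*_ e e
  ... | inj₂ e = trans (cong₂ ℚ._*_ e e)
                   (solve 1 (λ a → (:- a) :* (:- a) := a :* a) refl q)

  0≤sq : ∀ q → 0ℚ ℚ.≤ q ℚ.* q
  0≤sq q = subst (0ℚ ℚ.≤_) (∣q∣² q)
    (ℚ.nonNegative⁻¹ (ℚ.∣ q ∣ ℚ.* ℚ.∣ q ∣)
      {{ℚ.nonNeg*nonNeg⇒nonNeg ℚ.∣ q ∣ {{ℚ.∣-∣-nonNeg q}} ℚ.∣ q ∣ {{ℚ.∣-∣-nonNeg q}}}})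

  4ℚ 3ℚ : ℚ
  4ℚ = + 4 / 1
  3ℚ = + 3 / 1

  mono : ∀ {q r} → q ℚ.< r → cube q ℚ.< cube r
  mono {q} {r} q<r = ℚ.*-cancelˡ-<-nonNeg 4ℚ (0<-⇒< (subst (0ℚ ℚ.<_) eq pos))
    where
    d s : ℚ
    d = r ℚ.- q
    s = r ℚ.+ q
    instance
      d>0 : Positive d
      d>0 = positive (<⇒0<- q<r)
      dd>0 : Positive (d ℚ.* d)
      dd>0 = ℚ.pos*pos⇒pos d d
      ss≥0 : NonNegative (s ℚ.* s)
      ss≥0 = nonNegative (0≤sq s)
      3ss≥0 : NonNegative (3ℚ ℚ.* (s ℚ.* s))
      3ss≥0 = ℚ.nonNeg*nonNeg⇒nonNeg 3ℚ (s ℚ.* s)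
      sum>0 : Positive (d ℚ.* d ℚ.+ 3ℚ ℚ.* (s ℚ.* s))
      sum>0 = ℚ.pos+nonNeg⇒pos (d ℚ.* d) (3ℚ ℚ.* (s ℚ.* s))
    pos : 0ℚ ℚ.< d ℚ.* (d ℚ.* d ℚ.+ 3ℚ ℚ.* (s ℚ.* s))
    pos = ℚ.positive⁻¹ _
      {{ℚ.pos*pos⇒pos d (d ℚ.* d ℚ.+ 3ℚ ℚ.* (s ℚ.* s))}}
    eq : d ℚ.* (d ℚ.* d ℚ.+ 3ℚ ℚ.* (s ℚ.* s)) ≡ 4ℚ ℚ.* cube r ℚ.- 4ℚ ℚ.* cube q
    eq = solve 2 (λ q r →
      (r :- q) :* ((r :- q) :* (r :- q) :+ con 3ℚ :* ((r :+ q) :* (r :+ q)))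
      := con 4ℚ :* (r :* r :* r) :- con 4ℚ :* (q :* q :* q)) refl q r

  right : ∀ {q p} → cube q ℚ.< p → ∃ λ r → q ℚ.< r × cube r ℚ.< p
  right {q} {p} h = r , q<r , bound
    where
    t = proj₁ (ℚ.<-dense h)
    d = t ℚ.- cube q
    a = ℚ.∣ q ∣
    M = 3ℚ ℚ.* (a ℚ.* a) ℚ.+ 3ℚ ℚ.* a ℚ.+ 1ℚ
    instance
      d>0 : Positive d
      d>0 = positive (<⇒0<- (proj₁ (proj₂ (ℚ.<-dense h))))
      a≥0 : NonNegative a
      a≥0 = ℚ.∣-∣-nonNeg q
      aa≥0 : NonNegative (a ℚ.* a)
      aa≥0 = ℚ.nonNeg*nonNeg⇒nonNeg a a
      3aa≥0 : NonNegative (3ℚ ℚ.* (a ℚ.* a))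
      3aa≥0 = ℚ.nonNeg*nonNeg⇒nonNeg 3ℚ (a ℚ.* a)
      3a≥0 : NonNegative (3ℚ ℚ.* a)
      3a≥0 = ℚ.nonNeg*nonNeg⇒nonNeg 3ℚ a
      s≥0 : NonNegative (3ℚ ℚ.* (a ℚ.* a) ℚ.+ 3ℚ ℚ.* a)
      s≥0 = ℚ.nonNeg+nonNeg⇒nonNeg (3ℚ ℚ.* (a ℚ.* a)) (3ℚ ℚ.* a)
      M>0 : Positive M
      M>0 = ℚ.nonNeg+pos⇒pos (3ℚ ℚ.* (a ℚ.* a) ℚ.+ 3ℚ ℚ.* a) 1ℚ
      M≢0 : ℚ.NonZero M
      M≢0 = ℚ.pos⇒nonZero M
    M⁻¹ = 1/ M
    instance
      M⁻¹>0 : Positive M⁻¹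
      M⁻¹>0 = ℚ.1/pos⇒pos M
      dM⁻¹>0 : Positive (d ℚ.* M⁻¹)
      dM⁻¹>0 = ℚ.pos*pos⇒pos d M⁻¹
    ε = 1ℚ ℚ.⊓ (d ℚ.* M⁻¹)
    0<ε : 0ℚ ℚ.< ε
    0<ε with ℚ.≤-total 1ℚ (d ℚ.* M⁻¹)
    ... | inj₁ le = subst (0ℚ ℚ.<_) (sym (ℚ.p≤q⇒p⊓q≡p le)) (ℚ.positive⁻¹ 1ℚ)
    ... | inj₂ ge = subst (0ℚ ℚ.<_) (sym (ℚ.p≥q⇒p⊓q≡q ge)) (ℚ.positive⁻¹ (d ℚ.* M⁻¹))
    ε≤1 : ε ℚ.≤ 1ℚ
    ε≤1 = ℚ.p⊓q≤p 1ℚ (d ℚ.* M⁻¹)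
    instance
      ε≥0 : NonNegative ε
      ε≥0 = nonNegative (ℚ.<⇒≤ 0<ε)
    r = q ℚ.+ ε
    q<r : q ℚ.< r
    q<r = subst (ℚ._< r) (ℚ.+-identityʳ q) (ℚ.+-monoʳ-< q 0<ε)
    open ℚ.≤-Reasoning
    qε≤a : q ℚ.* ε ℚ.≤ a
    qε≤a = begin
      q ℚ.* ε   ≤⟨ ℚ.*-monoʳ-≤-nonNeg ε (q≤∣q∣ q) ⟩
      a ℚ.* ε   ≤⟨ ℚ.*-monoˡ-≤-nonNeg a ε≤1 ⟩
      a ℚ.* 1ℚ  ≡⟨ ℚ.*-identityʳ a ⟩
      a         ∎
    εε≤1 : ε ℚ.* ε ℚ.≤ 1ℚ
    εε≤1 = begin
      ε ℚ.* ε   ≤⟨ ℚ.*-monoˡ-≤-nonNeg ε ε≤1 ⟩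
      ε ℚ.* 1ℚ  ≡⟨ ℚ.*-identityʳ ε ⟩
      ε         ≤⟨ ε≤1 ⟩
      1ℚ        ∎
    bound : cube r ℚ.< p
    bound = begin-strict
      cube r
        ≡⟨ solve 2 (λ q e → (q :+ e) :* (q :+ e) :* (q :+ e)
             := q :* q :* q :+ e :* (con 3ℚ :* (q :* q) :+ con 3ℚ :* (q :* e) :+ e :* e))
             refl q ε ⟩
      cube q ℚ.+ ε ℚ.* (3ℚ ℚ.* (q ℚ.* q) ℚ.+ 3ℚ ℚ.* (q ℚ.* ε) ℚ.+ ε ℚ.* ε)
        ≤⟨ ℚ.+-monoʳ-≤ (cube q) (ℚ.*-monoˡ-≤-nonNeg ε
             (ℚ.+-mono-≤ (ℚ.+-mono-≤
               (ℚ.≤-reflexive (cong (3ℚ ℚ.*_) (sym (∣q∣² q))))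
               (ℚ.*-monoˡ-≤-nonNeg 3ℚ qε≤a)) εε≤1)) ⟩
      cube q ℚ.+ ε ℚ.* M
        ≤⟨ ℚ.+-monoʳ-≤ (cube q)
             (ℚ.*-monoʳ-≤-nonNeg M {{ℚ.pos⇒nonNeg M}} (ℚ.p⊓q≤q 1ℚ (d ℚ.* M⁻¹))) ⟩
      cube q ℚ.+ d ℚ.* M⁻¹ ℚ.* M
        ≡⟨ cong (cube q ℚ.+_) (trans (ℚ.*-assoc d M⁻¹ M)
             (trans (cong (d ℚ.*_) (ℚ.*-inverseˡ M)) (ℚ.*-identityʳ d))) ⟩
      cube q ℚ.+ d
        ≡⟨ solve 2 (λ c t → c :+ (t :- c) := t) refl (cube q) t ⟩
      t
        <⟨ proj₂ (proj₂ (ℚ.<-dense h)) ⟩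
      p ∎

  left : ∀ {r p} → p ℚ.< cube r → ∃ λ q → q ℚ.< r × p ℚ.< cube q
  left {r} {p} h =
    let s , -r<s , s³<-p = right {ℚ.- r} {ℚ.- p}
          (subst (ℚ._< ℚ.- p) (sym (cube-neg r)) (ℚ.neg-antimono-< h))
    in ℚ.- s
       , subst (ℚ.- s ℚ.<_) (neg-neg r) (ℚ.neg-antimono-< -r<s)
       , subst₂ ℚ._<_ (neg-neg p) (sym (cube-neg s)) (ℚ.neg-antimono-< s³<-p)

  above : ∀ p → ∃ λ q → p ℚ.< cube q
  above p = b , (begin-strict
    p              ≤⟨ q≤∣q∣ p ⟩
    a              <⟨ p<p+1 a ⟩
    b              ≡⟨ ℚ.*-identityʳ b ⟨
    b ℚ.* 1ℚ       ≤⟨ ℚ.*-monoˡ-≤-nonNeg b 1≤b ⟩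
    b ℚ.* b        ≡⟨ ℚ.*-identityʳ (b ℚ.* b) ⟨
    b ℚ.* b ℚ.* 1ℚ ≤⟨ ℚ.*-monoˡ-≤-nonNeg (b ℚ.* b) 1≤b ⟩
    cube b         ∎)
    where
    open ℚ.≤-Reasoning
    a = ℚ.∣ p ∣
    b = a ℚ.+ 1ℚ
    1≤b : 1ℚ ℚ.≤ b
    1≤b = subst (ℚ._≤ b) (ℚ.+-identityˡ 1ℚ) (ℚ.+-monoˡ-≤ 1ℚ (ℚ.0≤∣p∣ p))
    instance
      b≥0 : NonNegative b
      b≥0 = nonNegative (ℚ.≤-trans (ℚ.nonNegative⁻¹ 1ℚ) 1≤b)
      bb≥0 : NonNegative (b ℚ.* b)
      bb≥0 = nonNegative (0≤sq b)

  below : ∀ p → ∃ λ q → cube q ℚ.< p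
  below p = let q , -p<q³ = above (ℚ.- p) in
    ℚ.- q , subst₂ ℚ._<_ (sym (cube-neg q)) (neg-neg p) (ℚ.neg-antimono-< -p<q³)

-- The cube root: q < ∛ x iff q³ < x.
∛ : ℝ → ℝ
∛ = pullback cube mono below above right left
  where open Cube

{-# OPTIONS --safe #-}

-- Write b for the booksize, c(uv) for the codegree of an edge uv, and suppose
-- b ≤ n/6. A vertex adjacent to i of the three vertices of a triangle
-- contributes C(i,2) - i + 1 ≥ 0 to the sum of the three codegrees plus n minus
-- the sum of the three degrees. Adding this over all triangles gives
-- Σ c(uv) (c(uv) - s(uv)/2 - n/6) ≥ 0 over the edges, s(uv) = d(u) + d(v) - n.
-- As s ≤ c ≤ n/6, each term is at most -(n/12) s(uv), so that Σ s(uv) ≤ 0, that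
-- is, Σ d(v)² ≤ n m. Hence Σ (n - 2 d(v))² ≤ n³ - 4 n m ≤ 4 α n³.
--
-- Take a rational r with r³ < α < 9/4 r³ and let S be the set of vertices of
-- degree at least (1/2 - 3r/2) n. At most r n vertices lie outside S, so G[S] has
-- minimum degree at least (1/2 - 5r/2) n > 2/5 n. A triangle in S would have
-- degree sum at most n + 3 b, giving the large book, and a triangle-free graph
-- with minimum degree above 2/5 of its order is bipartite (Andrásfai).
-- The slack between r and α^(1/3) makes all case distinctions decidable.
module Submission where

open import Data.Bool.Base using (Bool; true; false; _∧_)
open import Data.Empty using (⊥; ⊥-elim)
open import Data.Fin.Base using (Fin; zero; suc)
import Data.Fin.Properties as Fin
open import Data.Fin.Subset using (Subset; ∣_∣; _∈_; _∩_; _∪_; ∁; ⊤; Empty; Nonempty)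
open import Data.Fin.Subset.Properties as Subset using (_∈?_)
open import Data.Integer.Base as ℤ using (ℤ; +_; 0ℤ; 1ℤ; +≤+)
import Data.Integer.Properties as ℤ
open import Data.Integer.Tactic.RingSolver using (solve-∀)
open import Data.List.Base as List
  using ([]; _∷_; allFin; cartesianProduct; filter; length; tabulate)
open import Data.List.Extrema.Nat using (xs≤max; argmin-sel)
open import Data.List.Membership.Propositional using () renaming (_∈_ to _∈ˡ_)
open import Data.List.Membership.Propositional.Properties
  using (∈-filter⁺; ∈-filter⁻; ∈-cartesianProduct⁺; ∈-allFin; ∈-map⁺; ∈-map⁻)
import Data.List.Properties as List
import Data.List.Relation.Unary.All as All
open import Data.List.Relation.Unary.Any using (here; there)
import Data.Nat.Coprimality as Coprime
open import Data.Nat.Base as ℕ using (ℕ; zero; suc; z≤n)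
import Data.Nat.Properties as ℕ
open import Data.Product.Base using (_×_; _,_; ∃; proj₁; proj₂)
open import Data.Rational.Base as ℚ using (ℚ; mkℚ; 0ℚ; 1ℚ; _/_; ↥_; ↧_; ↧ₙ_)
import Data.Rational.Properties as ℚ
open import Data.Rational.Solver using (module +-*-Solver)
open import Data.Rational.Unnormalised.Base using (mkℚᵘ; *≡*)
open import Data.Sum.Base using (_⊎_; inj₁; inj₂)
open import Data.Vec.Base as Vec using ([]; _∷_; lookup)
import Data.Vec.Properties as Vec
open import Defs hiding (_<_; _≤_; _>_; _≥_)
open import Function.Base using (_∘_; id; case_of_)
open import Relation.Binary.Definitions using (tri<; tri≈; tri>)
open import Relation.Binary.PropositionalEquality
  using (_≡_; refl; sym; trans; cong; cong₂; subst; subst₂; module ≡-Reasoning)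
open import Relation.Nullary using (Dec; does; yes; no; ¬_)
open import Relation.Nullary.Decidable using (_×-dec_; dec-true; dec-false; from-yes)
open import Relation.Unary using (Decidable)
open import Algebra.Properties.Semiring.Sum ℤ.+-*-semiring
  using (sum; sum-cong-≗; ∑-distrib-+; ∑-comm; *-distribˡ-sum; *-distribʳ-sum)

-- Nonnegativity and finite sums over the integers, and indicators of subsets.

module Sums where
  open import Data.Integer.Base using (_+_; _*_; _-_; _≤_)
  open ≡-Reasoning

  -- Most inequalities below are kept in the form `0ℤ ≤ expression`: combining them means adding and
  -- multiplying such facts and then rewriting along one ring identity.
  0≤+ : ∀ {i j} → 0ℤ ≤ i → 0ℤ ≤ j → 0ℤ ≤ i + j
  0≤+ = ℤ.+-mono-≤

  0≤* : ∀ {i j} → 0ℤ ≤ i → 0ℤ ≤ j → 0ℤ ≤ i * j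
  0≤* {+ m} {+ n} _ _ = subst (0ℤ ≤_) (ℤ.pos-* m n) (+≤+ z≤n)

  0≤+n : ∀ {n} → 0ℤ ≤ + n
  0≤+n = +≤+ z≤n

  0≤² : ∀ i → 0ℤ ≤ i * i
  0≤² (+ n)        = 0≤* {+ n} 0≤+n 0≤+n
  0≤² (ℤ.-[1+ n ]) = 0≤+n

  0<* : ∀ {i j} → 0ℤ ℤ.< i → 0ℤ ℤ.< j → 0ℤ ℤ.< i * j
  0<* {i} {j} 0<i 0<j =
    subst (ℤ._< i * j) (ℤ.*-zeroʳ i) (ℤ.*-monoˡ-<-pos i {{ℤ.positive 0<i}} 0<j)

  0≤-cancel : ∀ {k i} → 0ℤ ℤ.< k → 0ℤ ≤ k * i → 0ℤ ≤ i
  0≤-cancel {k} {i} 0<k h = ℤ.*-cancelˡ-≤-pos 0ℤ i k {{ℤ.positive 0<k}}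
    (subst (_≤ k * i) (sym (ℤ.*-zeroʳ k)) h)

  sum-nonneg : ∀ {n} {f : Fin n → ℤ} → (∀ i → 0ℤ ≤ f i) → 0ℤ ≤ sum f
  sum-nonneg {zero}  h = 0≤+n
  sum-nonneg {suc n} h = 0≤+ (h zero) (sum-nonneg (λ i → h (suc i)))

  sum-const : ∀ n k → sum {n} (λ _ → k) ≡ + n * k
  sum-const zero    k = refl
  sum-const (suc n) k = trans (cong (_+_ k) (sum-const n k))
                              (sym (ℤ.suc-* (+ n) k))

  sum-distrib-- : ∀ {k} (f g : Fin k → ℤ) → sum (λ i → f i - g i) ≡ sum f - sum g
  sum-distrib-- {k} f g = begin
    sum (λ i → f i - g i)             ≡⟨ ∑-distrib-+ f (λ i → ℤ.- g i) ⟩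
    sum f + sum (λ i → ℤ.- g i)
      ≡⟨ cong (_+_ (sum f)) (sum-cong-≗ (λ i → sym (ℤ.-1*i≡-i (g i)))) ⟩
    sum f + sum (λ i → ℤ.-1ℤ * g i)   ≡⟨ cong (_+_ (sum f)) (*-distribˡ-sum ℤ.-1ℤ g) ⟨
    sum f + ℤ.-1ℤ * sum g             ≡⟨ cong (_+_ (sum f)) (ℤ.-1*i≡-i (sum g)) ⟩
    sum f - sum g                     ∎

module Indicators where
  open import Data.Integer.Base using (_+_; _*_; _-_; _≤_)
  open Sums

  ⟦_⟧ : Bool → ℤ
  ⟦ true ⟧  = 1ℤ
  ⟦ false ⟧ = 0ℤ

  χ : ∀ {n} → Subset n → Fin n → ℤ
  χ p x = ⟦ lookup p x ⟧

  ⟦⟧-∧ : ∀ a b → ⟦ a ∧ b ⟧ ≡ ⟦ a ⟧ * ⟦ b ⟧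
  ⟦⟧-∧ true  true  = refl
  ⟦⟧-∧ true  false = refl
  ⟦⟧-∧ false b     = refl

  χ-∩ : ∀ {n} (p q : Subset n) x → χ (p ∩ q) x ≡ χ p x * χ q x
  χ-∩ p q x = trans (cong ⟦_⟧ (Vec.lookup-zipWith _∧_ x p q))
                    (⟦⟧-∧ (lookup p x) (lookup q x))

  0≤⟦⟧ : ∀ b → 0ℤ ≤ ⟦ b ⟧
  0≤⟦⟧ true  = 0≤+n
  0≤⟦⟧ false = 0≤+n

  ∣∣-sum : ∀ {n} (p : Subset n) → + ∣ p ∣ ≡ sum (χ p)
  ∣∣-sum []          = refl
  ∣∣-sum (true ∷ p)  = trans (ℤ.pos-+ 1 ∣ p ∣) (cong (_+_ 1ℤ) (∣∣-sum p))
  ∣∣-sum (false ∷ p) = trans (∣∣-sum p) (sym (ℤ.+-identityˡ _))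

-- Degree and codegree sums over vertices, edges and triangles.

module Degrees {n : ℕ} (G : Graph n) where
  open import Data.Integer.Base using (_+_; _*_; _-_; _≤_)
  open Sums
  open Indicators
  open ≡-Reasoning

  a : Fin n → Fin n → ℤ
  a u v = χ (N G u) v

  a-sym : ∀ u v → a u v ≡ a v u
  a-sym u v with lookup (N G u) v in uv | lookup (N G v) u in vu
  ... | true  | true  = refl
  ... | false | false = refl
  ... | true  | false with () ← trans (sym vu) (Vec.[]=⇒lookup (N-sym G (Vec.lookup⇒[]= v _ uv)))
  ... | false | true  with () ← trans (sym uv) (Vec.[]=⇒lookup (N-sym G (Vec.lookup⇒[]= u _ vu)))

  0≤a : ∀ u v → 0ℤ ≤ a u v
  0≤a u v = 0≤⟦⟧ _

  d : Fin n → ℤ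
  d u = + ∣ N G u ∣

  c : Fin n → Fin n → ℤ
  c u v = + ∣ N G u ∩ N G v ∣

  d-sum : ∀ u → d u ≡ sum (a u)
  d-sum u = ∣∣-sum (N G u)

  c-sum : ∀ u v → c u v ≡ sum (λ w → a u w * a v w)
  c-sum u v = trans (∣∣-sum (N G u ∩ N G v)) (sum-cong-≗ (χ-∩ (N G u) (N G v)))

  -- A vertex adjacent to i of `u`, `v`, `w` contributes C(i,2) - i + 1 = (i - 1)(i - 2)/2, which
  -- `bits` checks over the eight patterns. It serves twice: summed over all triangles, and for a
  -- single triangle of high degrees.
  three-degrees : ∀ u v w → 0ℤ ≤ c u v + c v w + c u w + + n - (d u + d v + d w)
  three-degrees u v w = subst (0ℤ ≤_) eq (sum-nonneg pointwise)
    where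
    bits : ∀ p q r → 0ℤ ≤ ⟦ p ⟧ * ⟦ q ⟧ + ⟦ q ⟧ * ⟦ r ⟧ + ⟦ p ⟧ * ⟦ r ⟧ + 1ℤ
                           - (⟦ p ⟧ + ⟦ q ⟧ + ⟦ r ⟧)
    bits true  true  true  = 0≤+n
    bits true  true  false = 0≤+n
    bits true  false true  = 0≤+n
    bits true  false false = 0≤+n
    bits false true  true  = 0≤+n
    bits false true  false = 0≤+n
    bits false false true  = 0≤+n
    bits false false false = 0≤+n
    pointwise : ∀ x → 0ℤ ≤ a u x * a v x + a v x * a w x + a u x * a w x + 1ℤ
                            - (a u x + a v x + a w x)
    pointwise x = bits (lookup (N G u) x) (lookup (N G v) x) (lookup (N G w) x)
    +₃ : ∀ (f g h : Fin n → ℤ) → sum (λ x → f x + g x + h x) ≡ sum f + sum g + sum h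
    +₃ f g h = trans (∑-distrib-+ {n} _ h) (cong (_+ sum h) (∑-distrib-+ f g))
    eq : sum (λ x → a u x * a v x + a v x * a w x + a u x * a w x + 1ℤ
                     - (a u x + a v x + a w x))
         ≡ c u v + c v w + c u w + + n - (d u + d v + d w)
    eq = trans (sum-distrib-- {n} _ _) (cong₂ _-_
      (trans (∑-distrib-+ {n} _ _) (cong₂ _+_
        (trans (+₃ _ _ _) (sym (cong₂ _+_ (cong₂ _+_ (c-sum u v) (c-sum v w)) (c-sum u w))))
        (trans (sum-const n 1ℤ) (ℤ.*-identityʳ (+ n)))))
      (trans (+₃ _ _ _) (sym (cong₂ _+_ (cong₂ _+_ (d-sum u) (d-sum v)) (d-sum w)))))

  -- The union of two neighbourhoods has at most n vertices; pointwise, this is (1 - p)(1 - q) ≥ 0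
  -- for bits p and q.
  two-degrees : ∀ u v → 0ℤ ≤ c u v + + n - (d u + d v)
  two-degrees u v = subst (0ℤ ≤_) eq (sum-nonneg pointwise)
    where
    bits : ∀ p q → 0ℤ ≤ ⟦ p ⟧ * ⟦ q ⟧ + 1ℤ - (⟦ p ⟧ + ⟦ q ⟧)
    bits true  true  = 0≤+n
    bits true  false = 0≤+n
    bits false true  = 0≤+n
    bits false false = 0≤+n
    pointwise : ∀ x → 0ℤ ≤ a u x * a v x + 1ℤ - (a u x + a v x)
    pointwise x = bits (lookup (N G u) x) (lookup (N G v) x)
    eq : sum (λ x → a u x * a v x + 1ℤ - (a u x + a v x)) ≡ c u v + + n - (d u + d v)
    eq = trans (sum-distrib-- {n} _ _) (cong₂ _-_
      (trans (∑-distrib-+ {n} _ _) (cong₂ _+_ (sym (c-sum u v))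
        (trans (sum-const n 1ℤ) (ℤ.*-identityʳ (+ n)))))
      (trans (∑-distrib-+ {n} _ _) (sym (cong₂ _+_ (d-sum u) (d-sum v)))))

  ∑∑ : (Fin n → Fin n → ℤ) → ℤ
  ∑∑ f = sum (λ u → sum (f u))

  ∑∑∑ : (Fin n → Fin n → Fin n → ℤ) → ℤ
  ∑∑∑ f = sum (λ u → ∑∑ (f u))

  ∑∑-cong : ∀ {f g} → (∀ u v → f u v ≡ g u v) → ∑∑ f ≡ ∑∑ g
  ∑∑-cong h = sum-cong-≗ (λ u → sum-cong-≗ (h u))

  ∑∑∑-cong : ∀ {f g} → (∀ u v w → f u v w ≡ g u v w) → ∑∑∑ f ≡ ∑∑∑ g
  ∑∑∑-cong h = sum-cong-≗ (λ u → ∑∑-cong (h u))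

  ∑∑-+ : ∀ f g → ∑∑ (λ u v → f u v + g u v) ≡ ∑∑ f + ∑∑ g
  ∑∑-+ f g = trans (sum-cong-≗ (λ u → ∑-distrib-+ {n} (f u) (g u))) (∑-distrib-+ {n} _ _)

  ∑∑∑-+ : ∀ f g → ∑∑∑ (λ u v w → f u v w + g u v w) ≡ ∑∑∑ f + ∑∑∑ g
  ∑∑∑-+ f g = trans (sum-cong-≗ (λ u → ∑∑-+ (f u) (g u))) (∑-distrib-+ {n} _ _)

  -- The sum runs over ordered adjacent pairs, so each edge enters twice, and in `T` each triangle
  -- enters six times. This lets the summation variables be permuted freely.
  E : (Fin n → Fin n → ℤ) → ℤ
  E g = ∑∑ (λ u v → a u v * g u v)

  t : Fin n → Fin n → Fin n → ℤ
  t u v w = a u v * (a u w * a v w)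

  T : (Fin n → Fin n → Fin n → ℤ) → ℤ
  T g = ∑∑∑ (λ u v w → t u v w * g u v w)

  E-cong : ∀ {f g} → (∀ u v → f u v ≡ g u v) → E f ≡ E g
  E-cong h = ∑∑-cong (λ u v → cong (a u v *_) (h u v))

  E-+ : ∀ f g → E (λ u v → f u v + g u v) ≡ E f + E g
  E-+ f g = trans (∑∑-cong (λ u v → ℤ.*-distribˡ-+ (a u v) _ _)) (∑∑-+ _ _)

  E-*ˡ : ∀ k f → E (λ u v → k * f u v) ≡ k * E f
  E-*ˡ k f = begin
    ∑∑ (λ u v → a u v * (k * f u v))        ≡⟨ ∑∑-cong (λ u v → comm (a u v) k (f u v)) ⟩
    ∑∑ (λ u v → k * (a u v * f u v))
      ≡⟨ sum-cong-≗ (λ u → sym (*-distribˡ-sum k (λ v → a u v * f u v))) ⟩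
    sum (λ u → k * sum (λ v → a u v * f u v))
      ≡⟨ *-distribˡ-sum k (λ u → sum (λ v → a u v * f u v)) ⟨
    k * E f                                  ∎
    where
    comm : ∀ x y z → x * (y * z) ≡ y * (x * z)
    comm = solve-∀

  T-+ : ∀ f g → T (λ u v w → f u v w + g u v w) ≡ T f + T g
  T-+ f g = trans (∑∑∑-cong (λ u v w → ℤ.*-distribˡ-+ (t u v w) _ _)) (∑∑∑-+ _ _)

  module _ (g : Fin n → Fin n → ℤ) where

    -- For fixed `u` and `v`, summing out `w` counts the triangles on the edge. The versions for the
    -- other two sides follow by exchanging sums, since `t` is symmetric.
    T-uv : T (λ u v w → g u v) ≡ E (λ u v → c u v * g u v)
    T-uv = ∑∑-cong λ u v → begin
      sum (λ w → t u v w * g u v)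
        ≡⟨ sum-cong-≗ (λ w → assoc (a u v) (a u w * a v w) (g u v)) ⟩
      sum (λ w → a u v * g u v * (a u w * a v w))
        ≡⟨ *-distribˡ-sum (a u v * g u v) (λ w → a u w * a v w) ⟨
      a u v * g u v * sum (λ w → a u w * a v w)
        ≡⟨ cong (a u v * g u v *_) (c-sum u v) ⟨
      a u v * g u v * c u v
        ≡⟨ trans (ℤ.*-assoc (a u v) _ _) (cong (a u v *_) (ℤ.*-comm (g u v) (c u v))) ⟩
      a u v * (c u v * g u v) ∎
      where
      assoc : ∀ x y z → x * y * z ≡ x * z * y
      assoc = solve-∀

    T-uw : T (λ u v w → g u w) ≡ E (λ u v → c u v * g u v)
    T-uw = begin
      ∑∑∑ (λ u v w → t u v w * g u w)
        ≡⟨ sum-cong-≗ (λ u → ∑-comm (λ v w → t u v w * g u w)) ⟩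
      ∑∑∑ (λ u w v → t u v w * g u w)
        ≡⟨ ∑∑∑-cong (λ u w v → cong (_* g u w)
             (trans (cong (λ x → a u v * (a u w * x)) (a-sym v w))
                    (comm (a u v) (a u w) (a w v)))) ⟩
      ∑∑∑ (λ u w v → t u w v * g u w)
        ≡⟨ T-uv ⟩
      E (λ u v → c u v * g u v) ∎
      where
      comm : ∀ x y z → x * (y * z) ≡ y * (x * z)
      comm = solve-∀

    T-vw : T (λ u v w → g v w) ≡ E (λ u v → c u v * g u v)
    T-vw = begin
      ∑∑∑ (λ u v w → t u v w * g v w)
        ≡⟨ ∑-comm (λ u v → sum (λ w → t u v w * g v w)) ⟩
      ∑∑∑ (λ v u w → t u v w * g v w)
        ≡⟨ ∑∑∑-cong (λ v u w → cong (_* g v w)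
             (cong₂ _*_ (a-sym u v) (ℤ.*-comm (a u w) (a v w)))) ⟩
      T (λ v u w → g v w)
        ≡⟨ T-uw ⟩
      E (λ u v → c u v * g u v) ∎

  E-1 : E (λ _ _ → 1ℤ) ≡ sum d
  E-1 = sum-cong-≗ (λ u → trans (sum-cong-≗ (λ v → ℤ.*-identityʳ (a u v))) (sym (d-sum u)))

  E-du : E (λ u _ → d u) ≡ sum (λ u → d u * d u)
  E-du = sum-cong-≗ λ u → begin
    sum (λ v → a u v * d u) ≡⟨ *-distribʳ-sum (d u) (a u) ⟨
    sum (a u) * d u         ≡⟨ cong (_* d u) (d-sum u) ⟨
    d u * d u               ∎

  E-dv : E (λ _ v → d v) ≡ sum (λ u → d u * d u)
  E-dv = begin
    ∑∑ (λ u v → a u v * d v) ≡⟨ ∑-comm (λ u v → a u v * d v) ⟩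
    ∑∑ (λ v u → a u v * d v) ≡⟨ ∑∑-cong (λ v u → cong (_* d v) (a-sym u v)) ⟩
    ∑∑ (λ v u → a v u * d v) ≡⟨ E-du ⟩
    sum (λ u → d u * d u)    ∎

  -- With D = d u + d v, summing three-degrees over the triangles gives
  -- 0 ≤ E (c (6 c + 2 n - 3 D)), and then the identity
  -- n (n - D) = (n - 6 c) (2 c + n - D) + 2 c (6 c + 2 n - 3 D)
  -- gives 0 ≤ E (n - D).
  degree-squares : 0ℤ ℤ.< + n → (∀ u v → 0ℤ ≤ a u v * (+ n - + 6 * c u v)) →
                   0ℤ ≤ + n * sum d - + 2 * sum (λ u → d u * d u)
  degree-squares 0<n small = 0≤-cancel 0<n (subst (0ℤ ≤_) eq (0≤+ nonneg₁ (0≤* {+ 2} 0≤+n nonneg₂)))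
    where
    ψ : Fin n → Fin n → ℤ
    ψ u v = + 2 * c u v - (d u + d v)
    g₁ : Fin n → Fin n → ℤ
    g₁ u v = (+ n - + 6 * c u v) * (+ 2 * c u v + + n - (d u + d v))
    cψ : Fin n → Fin n → ℤ
    cψ u v = c u v * ψ u v
    nonneg₁ : 0ℤ ≤ E g₁
    nonneg₁ = sum-nonneg λ u → sum-nonneg λ v → subst (0ℤ ≤_) (ℤ.*-assoc (a u v) _ _)
      (0≤* (small u v) (subst (0ℤ ≤_) (shift (c u v) (+ n) (d u + d v))
        (0≤+ (0≤+n {∣ N G u ∩ N G v ∣}) (two-degrees u v))))
      where
      shift : ∀ x y z → x + (x + y - z) ≡ + 2 * x + y - z
      shift = solve-∀
    -- Doubling `three-degrees` gives each side of the triangle the full degrees of its two ends.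
    -- The whole `+ 2 * + n` is put on the side `u v`; by symmetry of the triangle sum any
    -- distribution would give the same total.
    nonneg₂ : 0ℤ ≤ E (λ u v → c u v * (ψ u v + + 2 * + n)) + (E cψ + E cψ)
    nonneg₂ = subst (0ℤ ≤_)
      (trans (T-+ _ _) (cong₂ _+_ (T-uv (λ u v → ψ u v + + 2 * + n))
        (trans (T-+ _ _) (cong₂ _+_ (T-vw ψ) (T-uw ψ)))))
      (sum-nonneg λ u → sum-nonneg λ v → sum-nonneg λ w →
        0≤* (0≤* (0≤a u v) (0≤* (0≤a u w) (0≤a v w)))
            (subst (0ℤ ≤_) (rearrange (c u v) (c v w) (c u w) (+ n) (d u) (d v) (d w))
              (0≤* {+ 2} 0≤+n (three-degrees u v w))))
      where
      rearrange : ∀ x y z m p q r → + 2 * (x + y + z + m - (p + q + r)) ≡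
        (+ 2 * x - (p + q) + + 2 * m) + ((+ 2 * y - (q + r)) + (+ 2 * z - (p + r)))
      rearrange = solve-∀
    Q = sum (λ u → d u * d u)
    pull : ∀ k → E (λ _ _ → k) ≡ k * sum d
    pull k = trans (E-cong (λ _ _ → sym (ℤ.*-identityʳ k)))
      (trans (E-*ˡ k (λ _ _ → 1ℤ)) (cong (k *_) E-1))
    eq : E g₁ + + 2 * (E (λ u v → c u v * (ψ u v + + 2 * + n)) + (E cψ + E cψ))
         ≡ + n * (+ n * sum d - + 2 * Q)
    eq = begin
      E g₁ + + 2 * (E (λ u v → c u v * (ψ u v + + 2 * + n)) + (E cψ + E cψ))
        ≡⟨ cong (λ z → E g₁ + + 2 * z) (trans
             (cong (_+_ (E (λ u v → c u v * (ψ u v + + 2 * + n)))) (sym (E-+ _ _)))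
             (sym (E-+ _ _))) ⟩
      E g₁ + + 2 * E (λ u v → c u v * (ψ u v + + 2 * + n) + (cψ u v + cψ u v))
        ≡⟨ trans (cong (_+_ (E g₁)) (sym (E-*ˡ (+ 2) _))) (sym (E-+ _ _)) ⟩
      E (λ u v → g₁ u v + + 2 * (c u v * (ψ u v + + 2 * + n) + (cψ u v + cψ u v)))
        ≡⟨ E-cong (λ u v → identity (c u v) (d u) (d v) (+ n)) ⟩
      E (λ u v → + n * (+ n + ℤ.-1ℤ * (d u + d v)))
        ≡⟨ E-*ˡ (+ n) _ ⟩
      + n * E (λ u v → + n + ℤ.-1ℤ * (d u + d v))
        ≡⟨ cong (+ n *_) (trans (E-+ _ _) (cong₂ _+_ (pull (+ n))
             (trans (E-*ˡ ℤ.-1ℤ _) (cong (ℤ.-1ℤ *_) (trans (E-+ _ _) (cong₂ _+_ E-du E-dv)))))) ⟩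
      + n * (+ n * sum d + ℤ.-1ℤ * (Q + Q))
        ≡⟨ cong (+ n *_) (tidy (+ n * sum d) Q) ⟩
      + n * (+ n * sum d - + 2 * Q) ∎
      where
      tidy : ∀ x y → x + ℤ.-1ℤ * (y + y) ≡ x - + 2 * y
      tidy = solve-∀
      identity : ∀ x p q m →
        (m - + 6 * x) * (+ 2 * x + m - (p + q)) +
        + 2 * (x * (+ 2 * x - (p + q) + + 2 * m)
               + (x * (+ 2 * x - (p + q)) + x * (+ 2 * x - (p + q))))
        ≡ m * (m + ℤ.-1ℤ * (p + q))
      identity = solve-∀

-- Edge count, booksize and minimum degree, from lists to sums and bounds.

module Counting where
  open import Data.Integer.Base using (_+_; _*_; _-_; _≤_)
  open Indicators

  length-filter-tabulate : ∀ {A : Set} {P : A → Set} (P? : Decidable P) {k} (f : Fin k → A) →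
    + length (filter P? (tabulate f)) ≡ sum (λ i → ⟦ does (P? (f i)) ⟧)
  length-filter-tabulate P? {zero}  f = refl
  length-filter-tabulate P? {suc k} f with does (P? (f zero))
  ... | true  = trans (ℤ.pos-+ 1 (length (filter P? (tabulate (f ∘ suc)))))
                      (cong (_+_ 1ℤ) (length-filter-tabulate P? (f ∘ suc)))
  ... | false = trans (length-filter-tabulate P? (f ∘ suc)) (sym (ℤ.+-identityˡ _))

  length-filter-product : ∀ {A B : Set} {P : A × B → Set} (P? : Decidable P) {k l}
    (f : Fin k → A) (g : Fin l → B) →
    + length (filter P? (cartesianProduct (tabulate f) (tabulate g)))
    ≡ sum (λ i → sum (λ j → ⟦ does (P? (f i , g j)) ⟧))
  length-filter-product P? {zero}  f g = refl
  length-filter-product P? {suc k} f g = begin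
    + length (filter P? (row List.++ rest))
      ≡⟨ cong (+_ ∘ length) (List.filter-++ P? row rest) ⟩
    + length (filter P? row List.++ filter P? rest)
      ≡⟨ cong +_ (List.length-++ (filter P? row)) ⟩
    + (length (filter P? row) ℕ.+ length (filter P? rest))
      ≡⟨ ℤ.pos-+ (length (filter P? row)) _ ⟩
    + length (filter P? row) + + length (filter P? rest)
      ≡⟨ cong₂ _+_
           (trans (cong (+_ ∘ length ∘ filter P?) (List.map-tabulate g (f zero ,_)))
                  (length-filter-tabulate P? (λ j → f zero , g j)))
           (length-filter-product P? (f ∘ suc) g) ⟩
    sum (λ i → sum (λ j → ⟦ does (P? (f i , g j)) ⟧)) ∎
    where
    open ≡-Reasoning
    row  = List.map (f zero ,_) (tabulate g)
    rest = cartesianProduct (tabulate (f ∘ suc)) (tabulate g)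

does-∈? : ∀ {n} (p : Subset n) x → does (x ∈? p) ≡ lookup p x
does-∈? p x with lookup p x in eq
... | true  = dec-true (x ∈? p) (Vec.lookup⇒[]= x p eq)
... | false = dec-false (x ∈? p) λ x∈p →
  case trans (sym eq) (Vec.[]=⇒lookup x∈p) of λ ()

module _ {n : ℕ} (G : Graph n) where
  open import Data.Integer.Base using (_+_; _*_; _-_; _≤_)
  open Indicators
  open Degrees G

  -- `edges` holds each edge once, smaller endpoint first. Adding the transposed count covers all
  -- ordered pairs off the diagonal, and the diagonal contributes 0.
  handshake : + 2 * + ∣E∣ G ≡ sum d
  handshake = begin
    + 2 * + ∣E∣ G                                        ≡⟨ double (+ ∣E∣ G) ⟩
    + ∣E∣ G + + ∣E∣ G                                    ≡⟨ cong₂ _+_ count count′ ⟩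
    ∑∑ (λ u v → l u v * a u v) + ∑∑ (λ u v → l v u * a u v) ≡⟨ ∑∑-+ _ _ ⟨
    ∑∑ (λ u v → l u v * a u v + l v u * a u v)           ≡⟨ ∑∑-cong split ⟩
    ∑∑ a                                                 ≡⟨ sum-cong-≗ (λ u → sym (d-sum u)) ⟩
    sum d                                                ∎
    where
    open ≡-Reasoning
    l : Fin n → Fin n → ℤ
    l u v = ⟦ does (u Fin.<? v) ⟧
    double : ∀ i → + 2 * i ≡ i + i
    double = solve-∀
    count : + ∣E∣ G ≡ ∑∑ (λ u v → l u v * a u v)
    count = trans (Counting.length-filter-product
        (λ (u , v) → (u Fin.<? v) ×-dec (v ∈? N G u)) {n} {n} id id)
      (∑∑-cong (λ u v → trans (⟦⟧-∧ (does (u Fin.<? v)) _)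
        (cong (λ b → l u v * ⟦ b ⟧) (does-∈? (N G u) v))))
    count′ : + ∣E∣ G ≡ ∑∑ (λ u v → l v u * a u v)
    count′ = trans count (trans (∑-comm (λ u v → l u v * a u v))
      (∑∑-cong (λ v u → cong (l u v *_) (a-sym u v))))
    a-irrefl : ∀ u → a u u ≡ 0ℤ
    a-irrefl u with lookup (N G u) u in eq
    ... | true  = ⊥-elim (N-irrefl G (Vec.lookup⇒[]= u _ eq))
    ... | false = refl
    split : ∀ u v → l u v * a u v + l v u * a u v ≡ a u v
    split u v with Fin.<-cmp u v
    ... | tri< u<v _ v≮u rewrite dec-true (u Fin.<? v) u<v | dec-false (v Fin.<? u) v≮u =
      trans (ℤ.+-identityʳ _) (ℤ.*-identityˡ _)
    ... | tri> u≮v _ v<u rewrite dec-false (u Fin.<? v) u≮v | dec-true (v Fin.<? u) v<u =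
      trans (ℤ.+-identityˡ _) (ℤ.*-identityˡ _)
    ... | tri≈ _ refl _ rewrite a-irrefl u = cong₂ _+_ (ℤ.*-zeroʳ (l u u)) (ℤ.*-zeroʳ (l u u))

  ordered-codegree≤bk : ∀ {u v} → u Data.Fin.Base.< v → v ∈ N G u →
                        ∣ N G u ∩ N G v ∣ ℕ.≤ bk G
  ordered-codegree≤bk {u} {v} u<v uv =
    All.lookup (xs≤max 0 (List.map (λ (u , v) → ∣ N G u ∩ N G v ∣) (edges G)))
      (∈-map⁺ _ (∈-filter⁺ _ (∈-cartesianProduct⁺ (∈-allFin u) (∈-allFin v)) (u<v , uv)))

  codegree≤bk : ∀ {u v} → v ∈ N G u → ∣ N G u ∩ N G v ∣ ℕ.≤ bk G
  codegree≤bk {u} {v} uv with Fin.<-cmp u v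
  ... | tri< u<v _ _    = ordered-codegree≤bk u<v uv
  ... | tri≈ _ refl _   = ⊥-elim (N-irrefl G uv)
  ... | tri> _ _ v<u    = subst (ℕ._≤ bk G) (cong ∣_∣ (Subset.∩-comm (N G v) (N G u)))
    (ordered-codegree≤bk v<u (N-sym G uv))

  -- Transfers a bound valid for every vertex of `S` to `δ G S`. Nonemptiness excludes the default
  -- value 0 of the empty minimum.
  δ-attained : ∀ {S} → Nonempty S → ∃ λ u → u ∈ S × δ G S ≡ ∣ N G u ∩ S ∣
  δ-attained {S} (x , x∈S) with filter (_∈? S) (allFin n) in eq
  ... | [] with () ← subst (x ∈ˡ_) eq (∈-filter⁺ (_∈? S) (∈-allFin x) x∈S)
  ... | u ∷ us with argmin-sel id (∣ N G u ∩ S ∣) (List.map (λ v → ∣ N G v ∩ S ∣) us)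
  ...   | inj₁ e =
    u , proj₂ (∈-filter⁻ (_∈? S) {xs = allFin n} (subst (u ∈ˡ_) (sym eq) (here refl))) , e
  ...   | inj₂ i with v , v∈us , e ← ∈-map⁻ (λ v → ∣ N G v ∩ S ∣) i =
    v , proj₂ (∈-filter⁻ (_∈? S) {xs = allFin n} (subst (v ∈ˡ_) (sym eq) (there v∈us))) , e

-- Cyclically disjoint sets and Andrásfai's theorem.

module Disjointness {n : ℕ} where
  open import Data.Integer.Base using (_+_; _*_; _-_; _≤_)
  open Sums
  open Indicators

  Disjoint : Subset n → Subset n → Set
  Disjoint p q = ∀ {x} → x ∈ p → x ∈ q → ⊥

  ∈-lookup : ∀ {p : Subset n} {x} → lookup p x ≡ true → x ∈ p
  ∈-lookup = Vec.lookup⇒[]= _ _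

  disjoint-triple : ∀ {p q r : Subset n} → Disjoint p q → Disjoint q r → Disjoint r p →
                    0ℤ ≤ + n - (+ ∣ p ∣ + + ∣ q ∣ + + ∣ r ∣)
  disjoint-triple {p} {q} {r} pq qr rp = subst (0ℤ ≤_) eq
    (sum-nonneg λ x → bits (lookup p x) (lookup q x) (lookup r x)
      (λ a b → pq (∈-lookup a) (∈-lookup b)) (λ a b → qr (∈-lookup a) (∈-lookup b))
      (λ a b → rp (∈-lookup a) (∈-lookup b)))
    where
    bits : ∀ a b c → (a ≡ true → b ≡ true → ⊥) → (b ≡ true → c ≡ true → ⊥) →
           (c ≡ true → a ≡ true → ⊥) → 0ℤ ≤ 1ℤ - (⟦ a ⟧ + ⟦ b ⟧ + ⟦ c ⟧)
    bits true  true  c     ab bc ca = ⊥-elim (ab refl refl)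
    bits true  false true  ab bc ca = ⊥-elim (ca refl refl)
    bits true  false false ab bc ca = 0≤+n
    bits false true  true  ab bc ca = ⊥-elim (bc refl refl)
    bits false true  false ab bc ca = 0≤+n
    bits false false true  ab bc ca = 0≤+n
    bits false false false ab bc ca = 0≤+n
    eq : sum (λ x → 1ℤ - (χ p x + χ q x + χ r x)) ≡ + n - (+ ∣ p ∣ + + ∣ q ∣ + + ∣ r ∣)
    eq = trans (sum-distrib-- {n} _ _) (cong₂ _-_
      (trans (sum-const n 1ℤ) (ℤ.*-identityʳ (+ n)))
      (trans (∑-distrib-+ {n} _ _) (cong₂ _+_
        (trans (∑-distrib-+ {n} _ _) (sym (cong₂ _+_ (∣∣-sum p) (∣∣-sum q))))
        (sym (∣∣-sum r)))))

  -- The sets containing a given point form an independent set of the 5-cycle, so there are at most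
  -- two of them.
  disjoint-5-cycle : ∀ {p q r s t : Subset n} → Disjoint p q → Disjoint q r → Disjoint r s →
    Disjoint s t → Disjoint t p →
    0ℤ ≤ + n * + 2 - (+ ∣ p ∣ + + ∣ q ∣ + + ∣ r ∣ + + ∣ s ∣ + + ∣ t ∣)
  disjoint-5-cycle {p} {q} {r} {s} {t} pq qr rs st tp = subst (0ℤ ≤_) eq
    (sum-nonneg λ x →
      bits (lookup p x) (lookup q x) (lookup r x) (lookup s x) (lookup t x)
      (λ a b → pq (∈-lookup a) (∈-lookup b)) (λ a b → qr (∈-lookup a) (∈-lookup b))
      (λ a b → rs (∈-lookup a) (∈-lookup b)) (λ a b → st (∈-lookup a) (∈-lookup b))
      (λ a b → tp (∈-lookup a) (∈-lookup b)))
    where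
    bits : ∀ a b c d e → (a ≡ true → b ≡ true → ⊥) → (b ≡ true → c ≡ true → ⊥) →
      (c ≡ true → d ≡ true → ⊥) → (d ≡ true → e ≡ true → ⊥) → (e ≡ true → a ≡ true → ⊥) →
      0ℤ ≤ + 2 - (⟦ a ⟧ + ⟦ b ⟧ + ⟦ c ⟧ + ⟦ d ⟧ + ⟦ e ⟧)
    bits true  true  _     _     _     ab bc cd de ea = ⊥-elim (ab refl refl)
    bits true  false true  true  _     ab bc cd de ea = ⊥-elim (cd refl refl)
    bits true  false true  false true  ab bc cd de ea = ⊥-elim (ea refl refl)
    bits true  false true  false false ab bc cd de ea = 0≤+n
    bits true  false false true  true  ab bc cd de ea = ⊥-elim (ea refl refl)
    bits true  false false true  false ab bc cd de ea = 0≤+n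
    bits true  false false false true  ab bc cd de ea = ⊥-elim (ea refl refl)
    bits true  false false false false ab bc cd de ea = 0≤+n
    bits false true  true  _     _     ab bc cd de ea = ⊥-elim (bc refl refl)
    bits false true  false true  true  ab bc cd de ea = ⊥-elim (de refl refl)
    bits false true  false true  false ab bc cd de ea = 0≤+n
    bits false true  false false true  ab bc cd de ea = 0≤+n
    bits false true  false false false ab bc cd de ea = 0≤+n
    bits false false true  true  _     ab bc cd de ea = ⊥-elim (cd refl refl)
    bits false false true  false true  ab bc cd de ea = 0≤+n
    bits false false true  false false ab bc cd de ea = 0≤+n
    bits false false false true  true  ab bc cd de ea = 0≤+n
    bits false false false true  false ab bc cd de ea = 0≤+n
    bits false false false false true  ab bc cd de ea = 0≤+n
    bits false false false false false ab bc cd de ea = 0≤+n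
    eq : sum (λ x → + 2 - (χ p x + χ q x + χ r x + χ s x + χ t x))
         ≡ + n * + 2 - (+ ∣ p ∣ + + ∣ q ∣ + + ∣ r ∣ + + ∣ s ∣ + + ∣ t ∣)
    eq = trans (sum-distrib-- {n} _ _) (cong₂ _-_
      (sum-const n (+ 2))
      (trans (∑-distrib-+ {n} _ _) (cong₂ _+_
        (trans (∑-distrib-+ {n} _ _) (cong₂ _+_
          (trans (∑-distrib-+ {n} _ _) (cong₂ _+_
            (trans (∑-distrib-+ {n} _ _) (sym (cong₂ _+_ (∣∣-sum p) (∣∣-sum q))))
            (sym (∣∣-sum r))))
          (sym (∣∣-sum s))))
        (sym (∣∣-sum t)))))

module Andrasfai {n : ℕ} (G : Graph n) (S : Subset n) where
  open import Data.Integer.Base using (_+_; _*_; _-_; _≤_)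
  open Sums
  open Disjointness
  open ≡-Reasoning

  TriangleFree : Set
  TriangleFree = ∀ {u v w} → u ∈ S → v ∈ S → w ∈ S → v ∈ N G u → w ∈ N G u → w ∈ N G v → ⊥

  module _ (triangle-free : TriangleFree) where

    private
      Γ : Fin n → Subset n
      Γ u = N G u ∩ S

      ∈Γ⁻ : ∀ u {x} → x ∈ Γ u → x ∈ N G u × x ∈ S
      ∈Γ⁻ u = Subset.x∈p∩q⁻ (N G u) S

    adjacent⇒disjoint : ∀ {u v} → u ∈ S → v ∈ S → v ∈ N G u → Disjoint (Γ u) (Γ v)
    adjacent⇒disjoint {u} {v} u∈S v∈S uv xu xv =
      let x∈Nu , x∈S = ∈Γ⁻ u xu ; x∈Nv , _ = ∈Γ⁻ v xv in
      triangle-free u∈S v∈S x∈S uv x∈Nu x∈Nv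

    -- Fix u ∈ S and split S according to whether a vertex has a neighbour in Γ u.
    -- Two adjacent vertices w, w′ that both do close a 5-walk u a w w′ a′, and
    -- two that both do not give disjoint sets Γ u, Γ w, Γ w′.
    bipartite : (∀ {u} → u ∈ S → 0ℤ ℤ.< + 5 * + ∣ Γ u ∣ - + 2 * + n) → Bipartite G S
    bipartite large with Subset.nonempty? S
    ... | no empty = S , S , Subset.∪-idem S
      , (λ (x , x∈) → empty (x , proj₁ (Subset.x∈p∩q⁻ S S x∈)))
      , (λ u∈S _ _ → empty (_ , u∈S)) , (λ u∈S _ _ → empty (_ , u∈S))
    ... | yes (u , u∈S) = S ∩ ∁ R , S ∩ R , union , disjoint-AB , A-independent , B-independent
      where
      reaches? : ∀ w → Dec (Nonempty (Γ u ∩ N G w))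
      reaches? w = Subset.nonempty? (Γ u ∩ N G w)
      R : Subset n
      R = Vec.tabulate (λ w → does (reaches? w))
      ∈R⁻ : ∀ {w} → w ∈ R → Nonempty (Γ u ∩ N G w)
      ∈R⁻ {w} w∈R with reaches? w in eq
      ... | yes reach = reach
      ... | no _ with () ← trans (sym (Vec.[]=⇒lookup w∈R))
                        (trans (Vec.lookup∘tabulate _ w) (cong does eq))
      ∈R⁺ : ∀ {w} → Nonempty (Γ u ∩ N G w) → w ∈ R
      ∈R⁺ {w} reach = ∈-lookup (trans (Vec.lookup∘tabulate _ w) (dec-true (reaches? w) reach))
      union : (S ∩ ∁ R) ∪ (S ∩ R) ≡ S
      union = begin
        (S ∩ ∁ R) ∪ (S ∩ R) ≡⟨ Subset.∩-distribˡ-∪ S (∁ R) R ⟨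
        S ∩ (∁ R ∪ R)       ≡⟨ cong (S ∩_) (trans (Subset.∪-comm (∁ R) R) (Subset.p∪∁p≡⊤ R)) ⟩
        S ∩ ⊤ ≡⟨ Subset.∩-identityʳ S ⟩
        S                   ∎
      disjoint-AB : Empty ((S ∩ ∁ R) ∩ (S ∩ R))
      disjoint-AB (x , x∈) =
        let x∈A , x∈B = Subset.x∈p∩q⁻ (S ∩ ∁ R) (S ∩ R) x∈ in
        Subset.x∈∁p⇒x∉p (proj₂ (Subset.x∈p∩q⁻ S (∁ R) x∈A)) (proj₂ (Subset.x∈p∩q⁻ S R x∈B))
      A-independent : Independent G (S ∩ ∁ R)
      -- Three disjoint sets of more than 2n/5 elements would have more than 6n/5 > n elements
      -- together; the combination reads 0 < -n.
      A-independent {w} {w′} w∈A w′∈A ww′ = ℤ.≤⇒≯ (ℤ.neg-mono-≤ (0≤+n {n}))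
        (subst (0ℤ ℤ.<_) (identity (+ n) (+ ∣ Γ u ∣) (+ ∣ Γ w ∣) (+ ∣ Γ w′ ∣))
          (ℤ.+-mono-≤-< (0≤* {+ 5} 0≤+n (disjoint-triple away-w
              (adjacent⇒disjoint w∈S w′∈S ww′) (λ p q → away-w′ q p)))
            (ℤ.+-mono-< (ℤ.+-mono-< (large u∈S) (large w∈S)) (large w′∈S))))
        where
        w∈S  = proj₁ (Subset.x∈p∩q⁻ S (∁ R) w∈A)
        w′∈S = proj₁ (Subset.x∈p∩q⁻ S (∁ R) w′∈A)
        away : ∀ {z} → z ∈ S ∩ ∁ R → Disjoint (Γ u) (Γ z)
        away {z} z∈A x∈Γu x∈Γz = Subset.x∈∁p⇒x∉p (proj₂ (Subset.x∈p∩q⁻ S (∁ R) z∈A))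
          (∈R⁺ (_ , Subset.x∈p∩q⁺ (x∈Γu , proj₁ (∈Γ⁻ z x∈Γz))))
        away-w  = away w∈A
        away-w′ = away w′∈A
        identity : ∀ m x y z → + 5 * (m - (x + y + z)) +
          (+ 5 * x - + 2 * m + (+ 5 * y - + 2 * m) + (+ 5 * z - + 2 * m)) ≡ ℤ.- m
        identity = solve-∀
      B-independent : Independent G (S ∩ R)
      B-independent {w} {w′} w∈B w′∈B ww′ =
        let w∈S  , w∈R  = Subset.x∈p∩q⁻ S R w∈B
            w′∈S , w′∈R = Subset.x∈p∩q⁻ S R w′∈B
            a  , a∈  = ∈R⁻ w∈R
            a′ , a′∈ = ∈R⁻ w′∈R
            a∈Γu  , wa   = Subset.x∈p∩q⁻ (Γ u) (N G w) a∈
            a′∈Γu , w′a′ = Subset.x∈p∩q⁻ (Γ u) (N G w′) a′∈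
            ua  , a∈S  = ∈Γ⁻ u a∈Γu
            ua′ , a′∈S = ∈Γ⁻ u a′∈Γu
        -- Five sets of more than 2n/5 elements have total size above 2n, against the bound 2n
        -- around the 5-cycle. The combination is exactly 0, so here the threshold 2/5 leaves no
        -- slack.
        in ℤ.<-irrefl refl
          (subst (0ℤ ℤ.<_)
            (identity (+ n) (+ ∣ Γ u ∣) (+ ∣ Γ a ∣) (+ ∣ Γ w ∣) (+ ∣ Γ w′ ∣) (+ ∣ Γ a′ ∣))
            (ℤ.+-mono-≤-< (0≤* {+ 5} 0≤+n (disjoint-5-cycle
                (adjacent⇒disjoint u∈S a∈S ua) (adjacent⇒disjoint a∈S w∈S (N-sym G wa))
                (adjacent⇒disjoint w∈S w′∈S ww′) (adjacent⇒disjoint w′∈S a′∈S w′a′)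
                (adjacent⇒disjoint a′∈S u∈S (N-sym G ua′))))
              (ℤ.+-mono-< (ℤ.+-mono-< (ℤ.+-mono-< (ℤ.+-mono-<
                (large u∈S) (large a∈S)) (large w∈S)) (large w′∈S)) (large a′∈S))))
        where
        identity : ∀ m p q r s t → + 5 * (m * + 2 - (p + q + r + s + t)) +
          (+ 5 * p - + 2 * m + (+ 5 * q - + 2 * m) + (+ 5 * r - + 2 * m)
           + (+ 5 * s - + 2 * m) + (+ 5 * t - + 2 * m)) ≡ 0ℤ
        identity = solve-∀

-- The high-degree set `S` and its induced subgraph.

-- Here k / M is the rational r of the proof; the inequalities involving r are
-- stated multiplied by powers of M.
module Core {n : ℕ} (G : Graph n) (k M : ℕ) where
  open import Data.Integer.Base using (_+_; _*_; _-_; _≤_; _<_)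
  open Sums
  open Indicators
  open Degrees G
  open ≡-Reasoning

  small-books : + 6 * + bk G ≤ + n → ∀ u v → 0ℤ ≤ a u v * (+ n - + 6 * c u v)
  small-books 6b≤n u v with lookup (N G u) v in uv
  ... | false = 0≤+n
  ... | true  = subst (0ℤ ≤_) (sym (ℤ.*-identityˡ _)) (ℤ.i≤j⇒0≤j-i (ℤ.≤-trans
    (ℤ.*-monoˡ-≤-nonNeg (+ 6) (+≤+ (codegree≤bk G (Vec.lookup⇒[]= v _ uv)))) 6b≤n))

  -- Restricting to `S` costs `v` at most the n - |S| vertices outside; pointwise (1 - p)(1 - q) ≥ 0
  -- again.
  induced-degree : ∀ S v → 0ℤ ≤ + n + + ∣ N G v ∩ S ∣ - (d v + + ∣ S ∣)
  induced-degree S v = subst (0ℤ ≤_) eq (sum-nonneg λ x → bits (lookup (N G v) x) (lookup S x))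
    where
    bits : ∀ p q → 0ℤ ≤ 1ℤ + ⟦ p ⟧ * ⟦ q ⟧ - (⟦ p ⟧ + ⟦ q ⟧)
    bits true  true  = 0≤+n
    bits true  false = 0≤+n
    bits false true  = 0≤+n
    bits false false = 0≤+n
    eq : sum (λ x → 1ℤ + a v x * χ S x - (a v x + χ S x)) ≡ + n + + ∣ N G v ∩ S ∣ - (d v + + ∣ S ∣)
    eq = trans (sum-distrib-- {n} _ _) (cong₂ _-_
      (trans (∑-distrib-+ {n} _ _) (cong₂ _+_
        (trans (sum-const n 1ℤ) (ℤ.*-identityʳ (+ n)))
        (trans (sum-cong-≗ (λ x → sym (χ-∩ (N G v) S x))) (sym (∣∣-sum (N G v ∩ S))))))
      (trans (∑-distrib-+ {n} _ _) (sym (cong₂ _+_ (d-sum v) (∣∣-sum S)))))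

  Q : ℤ
  Q = sum (λ u → d u * d u)

  m : ℤ
  m = + ∣E∣ G

  -- Measures how far the degrees are from n/2, with a factor 4. The handshake identity turns the
  -- linear term into -8nm.
  deviation : sum (λ v → (+ n - + 2 * d v) * (+ n - + 2 * d v))
              ≡ + n * (+ n * + n) - + 8 * (+ n * m) + + 4 * Q
  deviation = begin
    sum (λ v → (+ n - + 2 * d v) * (+ n - + 2 * d v))
      ≡⟨ sum-cong-≗ (λ v → expand (+ n) (d v)) ⟩
    sum (λ v → + n * + n + (ℤ.- (+ 4 * + n) * d v + + 4 * (d v * d v)))
      ≡⟨ trans (∑-distrib-+ {n} _ _)
           (cong (_+_ (sum {n} (λ _ → + n * + n))) (∑-distrib-+ {n} _ _)) ⟩
    sum {n} (λ _ → + n * + n) + (sum (λ v → ℤ.- (+ 4 * + n) * d v) + sum (λ v → + 4 * (d v * d v)))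
      ≡⟨ cong₂ _+_ (sum-const n (+ n * + n)) (cong₂ _+_
           (sym (*-distribˡ-sum (ℤ.- (+ 4 * + n)) d))
           (sym (*-distribˡ-sum (+ 4) (λ v → d v * d v)))) ⟩
    + n * (+ n * + n) + (ℤ.- (+ 4 * + n) * sum d + + 4 * Q)
      ≡⟨ cong (λ z → + n * (+ n * + n) + (ℤ.- (+ 4 * + n) * z + + 4 * Q)) (sym (handshake G)) ⟩
    + n * (+ n * + n) + (ℤ.- (+ 4 * + n) * (+ 2 * m) + + 4 * Q)
      ≡⟨ collect (+ n) m Q ⟩
    + n * (+ n * + n) - + 8 * (+ n * m) + + 4 * Q ∎
    where
    expand : ∀ x y → (x - + 2 * y) * (x - + 2 * y) ≡ x * x + (ℤ.- (+ 4 * x) * y + + 4 * (y * y))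
    expand = solve-∀
    collect : ∀ x y q → x * (x * x) + (ℤ.- (+ 4 * x) * (+ 2 * y) + + 4 * q)
                        ≡ x * (x * x) - + 8 * (x * y) + + 4 * q
    collect = solve-∀

  square-gap : ∀ {y z} → 0ℤ ≤ z → 0ℤ ≤ y - z → 0ℤ ≤ y * y - z * z
  square-gap {y} {z} 0≤z z≤y = subst (0ℤ ≤_) (identity y z)
    (0≤* z≤y (0≤+ z≤y (0≤* {+ 2} 0≤+n 0≤z)))
    where
    identity : ∀ y z → (y - z) * (y - z + + 2 * z) ≡ y * y - z * z
    identity = solve-∀

  -- This is d(v) - (1/2 - 3r/2) n multiplied by 2M, so that membership in `S` is an integer
  -- comparison.
  excess : Fin n → ℤ
  excess v = + 2 * (d v * + M) + + 3 * (+ k * + n) - + n * + M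

  S : Subset n
  S = Vec.tabulate (λ v → does (0ℤ ℤ.≤? excess v))

  ∈S⁻ : ∀ {v} → v ∈ S → 0ℤ ≤ excess v
  ∈S⁻ {v} v∈S with 0ℤ ℤ.≤? excess v in eq
  ... | yes h = h
  ... | no _ with () ← trans (sym (Vec.[]=⇒lookup v∈S))
                    (trans (Vec.lookup∘tabulate _ v) (cong does eq))

  -- Chebyshev's inequality: a vertex outside `S` has n - 2d(v) > 3rn and so adds more than 9r²n² to
  -- the deviation, while vertices of `S` add at least 0.
  low-degrees : 0ℤ ≤ + M * + M * (+ n * (+ n * + n) - + 8 * (+ n * m) + + 4 * Q)
                     - + 9 * (+ k * + k) * (+ n * + n) * (+ n - + ∣ S ∣)
  low-degrees = subst (0ℤ ≤_) eq (sum-nonneg pointwise)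
    where
    w = + 9 * (+ k * + k) * (+ n * + n)
    y : Fin n → ℤ
    y v = (+ n - + 2 * d v) * (+ n - + 2 * d v)
    pointwise : ∀ v → 0ℤ ≤ + M * + M * y v - w * (1ℤ - χ S v)
    pointwise v rewrite Vec.lookup∘tabulate (λ v → does (0ℤ ℤ.≤? excess v)) v
      with 0ℤ ℤ.≤? excess v
    ... | yes _ = subst (0ℤ ≤_) (drop (+ M * + M * y v) w)
                    (0≤* (0≤² (+ M)) (0≤² (+ n - + 2 * d v)))
      where
      drop : ∀ x w → x ≡ x - w * (1ℤ - 1ℤ)
      drop = solve-∀
    ... | no neg = subst (0ℤ ≤_) (regroup (+ M) (+ n) (d v) (+ k))
        (square-gap {(+ n - + 2 * d v) * + M} {+ 3 * (+ k * + n)}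
          (0≤* {+ 3} 0≤+n (0≤* {+ k} {+ n} 0≤+n 0≤+n))
          (subst (0ℤ ≤_) (flip (+ M) (+ n) (d v) (+ k))
            (ℤ.neg-mono-≤ (ℤ.<⇒≤ (ℤ.≰⇒> neg)))))
      where
      flip : ∀ M n d k → ℤ.- (+ 2 * (d * M) + + 3 * (k * n) - n * M)
                         ≡ (n - + 2 * d) * M - + 3 * (k * n)
      flip = solve-∀
      regroup : ∀ M n d k →
        (n - + 2 * d) * M * ((n - + 2 * d) * M) - + 3 * (k * n) * (+ 3 * (k * n))
        ≡ M * M * ((n - + 2 * d) * (n - + 2 * d)) - + 9 * (k * k) * (n * n) * (1ℤ - 0ℤ)
      regroup = solve-∀
    eq : sum (λ v → + M * + M * y v - w * (1ℤ - χ S v)) ≡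
         + M * + M * (+ n * (+ n * + n) - + 8 * (+ n * m) + + 4 * Q) - w * (+ n - + ∣ S ∣)
    eq = trans (sum-distrib-- {n} _ _) (cong₂ _-_
      (trans (sym (*-distribˡ-sum (+ M * + M) y)) (cong (_*_ (+ M * + M)) deviation))
      (trans (sym (*-distribˡ-sum w (λ v → 1ℤ - χ S v))) (cong (w *_)
        (trans (sum-distrib-- {n} _ _) (cong₂ _-_
          (trans (sum-const n 1ℤ) (ℤ.*-identityʳ (+ n))) (sym (∣∣-sum S)))))))

  -- Divided through, the last three hypotheses say r < 1/25, m ≥ (1/4 - 9r³/4) n² and b ≤ (1/6 -
  -- 2r) n.
  module Dense (0<n : 0ℤ < + n) (0<k : 0ℤ < + k) (0<M-25k : 0ℤ < + M - + 25 * + k)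
    (dense : 0ℤ ≤ + 4 * m * (+ M * + M * + M) + + 9 * (+ k * + k * + k) * (+ n * + n)
                  - + n * + n * (+ M * + M * + M))
    (books : 0ℤ ≤ + n * + M - (+ 6 * (+ bk G * + M) + + 12 * (+ k * + n))) where

    private
      0<kn : 0ℤ < + k * + n
      0<kn = 0<* 0<k 0<n

      0<M : 0ℤ < + M
      0<M = subst (0ℤ <_) (identity (+ M) (+ k))
        (ℤ.+-mono-<-≤ 0<M-25k (0≤* {+ 25} {+ k} 0≤+n 0≤+n))
        where
        identity : ∀ M k → M - + 25 * k + + 25 * k ≡ M
        identity = solve-∀

    -- Only the weakening 6b ≤ n of `books` enters, through `degree-squares`.
    squares : 0ℤ ≤ + n * m - Q
    squares = 0≤-cancel {+ 2} (ℤ.+<+ (ℕ.s≤s z≤n)) (subst (0ℤ ≤_)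
        (trans (cong (λ z → + n * z - + 2 * Q) (sym (handshake G))) (identity (+ n) m Q))
        (degree-squares 0<n (small-books (ℤ.0≤i-j⇒j≤i (0≤-cancel 0<M
          (subst (0ℤ ≤_) (split (+ n) (+ M) (+ bk G) (+ k))
            (0≤+ books (0≤* {+ 12} {+ k * + n} 0≤+n (ℤ.<⇒≤ 0<kn)))))))))
      where
      identity : ∀ n m q → n * (+ 2 * m) - + 2 * q ≡ + 2 * (n * m - q)
      identity = solve-∀
      split : ∀ n M b k → n * M - (+ 6 * (b * M) + + 12 * (k * n)) + + 12 * (k * n)
                          ≡ M * (n - + 6 * b)
      split = solve-∀

    -- The deviation is at most n³ - 4nm ≤ 9r³n³ by `squares` and `dense`, and at least 9r²n²(n -
    -- |S|) by `low-degrees`. Dividing gives n - |S| ≤ rn: the factor 9/4 in the bound on α and the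
    -- 3/2 in the degree threshold are matched for this.
    size : 0ℤ ≤ + k * + n - + M * (+ n - + ∣ S ∣)
    size = 0≤-cancel (0<* {+ 9} (ℤ.+<+ (ℕ.s≤s z≤n)) (0<* 0<kn 0<kn))
      (subst (0ℤ ≤_) (identity (+ n) m (+ M) (+ k) Q (+ ∣ S ∣))
        (0≤+ (0≤+ (0≤* {+ n} 0≤+n dense)
                  (0≤* (0≤* {+ 4 * + M} {+ M * + M} (0≤* {+ 4} {+ M} 0≤+n 0≤+n) (0≤² (+ M)))
                       squares))
             (0≤* {+ M} 0≤+n low-degrees)))
      where
      identity : ∀ n m M k q s →
        n * (+ 4 * m * (M * M * M) + + 9 * (k * k * k) * (n * n) - n * n * (M * M * M))
        + + 4 * M * (M * M) * (n * m - q)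
        + M * (M * M * (n * (n * n) - + 8 * (n * m) + + 4 * q) - + 9 * (k * k) * (n * n) * (n - s))
        ≡ + 9 * (k * n * (k * n)) * (k * n - M * (n - s))
      identity = solve-∀

    degree : ∀ {v} → v ∈ S → 0ℤ ≤ + 2 * (+ ∣ N G v ∩ S ∣ * + M) + + 5 * (+ k * + n) - + n * + M
    degree {v} v∈S = subst (0ℤ ≤_) (identity (+ n) (+ M) (+ k) (d v) (+ ∣ N G v ∩ S ∣) (+ ∣ S ∣))
      (0≤+ (0≤+ (0≤* {+ 2 * + M} (0≤* {+ 2} {+ M} 0≤+n 0≤+n) (induced-degree S v)) (∈S⁻ v∈S))
           (0≤* {+ 2} 0≤+n size))
      where
      identity : ∀ n M k d e s →
        + 2 * M * (n + e - (d + s)) + (+ 2 * (d * M) + + 3 * (k * n) - n * M)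
          + + 2 * (k * n - M * (n - s))
        ≡ + 2 * (e * M) + + 5 * (k * n) - n * M
      identity = solve-∀

    -- 1/2 - 5r/2 > 2/5 is equivalent to r < 1/25; this is where 25 comes from.
    large-degree : ∀ {v} → v ∈ S → 0ℤ < + 5 * + ∣ N G v ∩ S ∣ - + 2 * + n
    large-degree {v} v∈S = ℤ.*-cancelˡ-<-nonNeg (+ 2 * + M)
      {{ℤ.nonNegative (0≤* {+ 2} {+ M} 0≤+n 0≤+n)}}
      (subst₂ _<_ (sym (ℤ.*-zeroʳ (+ 2 * + M))) (identity (+ n) (+ M) (+ k) (+ ∣ N G v ∩ S ∣))
        (ℤ.+-mono-≤-< (0≤* {+ 5} 0≤+n (degree v∈S)) (0<* 0<n 0<M-25k)))
      where
      identity : ∀ n M k e → + 5 * (+ 2 * (e * M) + + 5 * (k * n) - n * M) + n * (M - + 25 * k)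
                             ≡ + 2 * M * (+ 5 * e - + 2 * n)
      identity = solve-∀

    -- The degree sum of a triangle in `S` is at least 3n/2 - 9rn/2, but by `three-degrees` at most
    -- n + 3b ≤ 3n/2 - 6rn. The gap 3rn/2, scaled by 2M, is the final 3kn.
    triangle-free : Andrasfai.TriangleFree G S
    triangle-free {u} {v} {w} u∈S v∈S w∈S uv uw vw = ℤ.≤⇒≯
      (subst (0ℤ ≤_) (identity (+ n) (+ M) (+ k) (+ bk G) (c u v) (c v w) (c u w) (d u) (d v) (d w))
        (0≤+ (0≤+ (0≤* {+ 2 * + M} (0≤* {+ 2} {+ M} 0≤+n 0≤+n) (0≤+ (three-degrees u v w)
                    (0≤+ (0≤+ (book uv) (book vw)) (book uw))))
                  (0≤+ (0≤+ (∈S⁻ u∈S) (∈S⁻ v∈S)) (∈S⁻ w∈S)))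
             books))
      (ℤ.neg-mono-< (0<* {+ 3} (ℤ.+<+ (ℕ.s≤s z≤n)) 0<kn))
      where
      book : ∀ {x y} → y ∈ N G x → 0ℤ ≤ + bk G - c x y
      book xy = ℤ.i≤j⇒0≤j-i (+≤+ (codegree≤bk G xy))
      identity : ∀ n M k b x y z p q r →
        + 2 * M * (x + y + z + n - (p + q + r) + (b - x + (b - y) + (b - z)))
        + (+ 2 * (p * M) + + 3 * (k * n) - n * M + (+ 2 * (q * M) + + 3 * (k * n) - n * M)
           + (+ 2 * (r * M) + + 3 * (k * n) - n * M))
        + (n * M - (+ 6 * (b * M) + + 12 * (k * n)))
        ≡ ℤ.- (+ 3 * (k * n))
      identity = solve-∀

    S-bipartite : Bipartite G S
    S-bipartite = Andrasfai.bipartite G S triangle-free large-degree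

    -- Provides the hypothesis of `δ-attained`. For empty `S`, `size` would read Mn ≤ kn, although M
    -- > 25k.
    S-nonempty : Nonempty S
    S-nonempty with Subset.nonempty? S
    ... | yes ne = ne
    ... | no empty = ⊥-elim (ℤ.≤⇒≯ size (subst (_< 0ℤ) eq
          (ℤ.neg-mono-< (ℤ.+-mono-<-≤ (0<* 0<n 0<M-25k)
            (0≤* {+ 24} {+ k * + n} 0≤+n (ℤ.<⇒≤ 0<kn))))))
      where
      identity : ∀ n M k → ℤ.- (n * (M - + 25 * k) + + 24 * (k * n)) ≡ k * n - M * (n - 0ℤ)
      identity = solve-∀
      eq : ℤ.- (+ n * (+ M - + 25 * + k) + + 24 * (+ k * + n)) ≡ + k * + n - + M * (+ n - + ∣ S ∣)
      eq = trans (identity (+ n) (+ M) (+ k)) (cong (λ s → + k * + n - + M * (+ n - + s))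
        (sym (trans (cong ∣_∣ (Subset.Empty-unique empty)) (Subset.∣⊥∣≡0 n))))

    min-degree : 0ℤ ≤ + 2 * (+ δ G S * + M) + + 5 * (+ k * + n) - + n * + M
    min-degree with v , v∈S , e ← δ-attained G S-nonempty rewrite e = degree v∈S

-- Clearing denominators between rationals and integers.

module Rationals where
  open import Data.Rational.Base using (_+_; _*_; _-_)

  ι : ℤ → ℚ
  ι i = i / 1

  private
    -- The normal form of `i / 1` with its coprimality proof explicit, so that rational sums and
    -- products unfold to integer ones.
    fraction : ℤ → ℚ
    fraction i = mkℚ i 0 (Coprime.sym (Coprime.1-coprimeTo ℤ.∣ i ∣))

    ι-fraction : ∀ i → ι i ≡ fraction i
    ι-fraction i = ℚ.↥p/↧p≡p (fraction i)

  ι-+ : ∀ i j → ι (i ℤ.+ j) ≡ ι i + ι j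
  ι-+ i j = sym (trans (cong₂ _+_ (ι-fraction i) (ι-fraction j))
    (cong ι (cong₂ ℤ._+_ (ℤ.*-identityʳ i) (ℤ.*-identityʳ j))))

  ι-* : ∀ i j → ι (i ℤ.* j) ≡ ι i * ι j
  ι-* i j = sym (cong₂ _*_ (ι-fraction i) (ι-fraction j))

  ι-neg : ∀ i → ι (ℤ.- i) ≡ ℚ.- ι i
  ι-neg i = trans (cong ι (sym (ℤ.-1*i≡-i i)))
    (trans (ι-* ℤ.-1ℤ i) (solve 1 (λ x → con (ι ℤ.-1ℤ) :* x := :- x) refl (ι i)))
    where open +-*-Solver

  ι-- : ∀ i j → ι (i ℤ.- j) ≡ ι i - ι j
  ι-- i j = trans (ι-+ i (ℤ.- j)) (cong (ℚ._+_ (ι i)) (ι-neg j))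

  ι-mono-≤ : ∀ {i j} → i ℤ.≤ j → ι i ℚ.≤ ι j
  ι-mono-≤ {i} {j} i≤j = subst₂ ℚ._≤_ (sym (ι-fraction i)) (sym (ι-fraction j))
    (ℚ.*≤* (subst₂ ℤ._≤_ (sym (ℤ.*-identityʳ i)) (sym (ℤ.*-identityʳ j)) i≤j))

  ι-mono-< : ∀ {i j} → i ℤ.< j → ι i ℚ.< ι j
  ι-mono-< {i} {j} i<j = subst₂ ℚ._<_ (sym (ι-fraction i)) (sym (ι-fraction j))
    (ℚ.*<* (subst₂ ℤ._<_ (sym (ℤ.*-identityʳ i)) (sym (ℤ.*-identityʳ j)) i<j))

  ι-cancel-< : ∀ {i j} → ι i ℚ.< ι j → i ℤ.< j
  ι-cancel-< {i} {j} h = ℤ.≰⇒> λ j≤i → ℚ.<-irrefl refl (ℚ.<-≤-trans h (ι-mono-≤ j≤i))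

  -- With p = A/D and q = B/D, comparisons move between ℚ and ℤ in both directions.
  module _ {p q : ℚ} (A B : ℤ) {D : ℤ} (0<D : 0ℤ ℤ.< D)
           (pD : p * ι D ≡ ι A) (qD : q * ι D ≡ ι B) where
    private instance
      D>0 : ℚ.Positive (ι D)
      D>0 = ℚ.positive (ι-mono-< 0<D)

    numerators-≤ : A ℤ.≤ B → p ℚ.≤ q
    numerators-≤ A≤B = ℚ.*-cancelʳ-≤-pos (ι D) (subst₂ ℚ._≤_ (sym pD) (sym qD) (ι-mono-≤ A≤B))

    numerators-< : A ℤ.< B → p ℚ.< q
    numerators-< A<B = ℚ.*-cancelʳ-<-nonNeg (ι D) {{ℚ.pos⇒nonNeg (ι D)}}
      (subst₂ ℚ._<_ (sym pD) (sym qD) (ι-mono-< A<B))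

    numerators-<⁻ : p ℚ.< q → A ℤ.< B
    numerators-<⁻ p<q = ι-cancel-< (subst₂ ℚ._<_ pD qD (ℚ.*-monoˡ-<-pos (ι D) p<q))

  r*↧r : ∀ r → r * ι (↧ r) ≡ ι (↥ r)
  r*↧r r@record{} = begin
    r * ι (↧ r)
      ≡⟨ cong (r *_) (ι-fraction (↧ r)) ⟩
    (↥ r ℤ.* ↧ r) / (↧ₙ r ℕ.* 1)
      ≡⟨ ℚ.fromℚᵘ-cong {mkℚᵘ (↥ r ℤ.* ↧ r) (ℚ.denominator-1 r ℕ.* 1)} {mkℚᵘ (↥ r) 0}
           (*≡* (trans (ℤ.*-identityʳ _) (cong (λ n → ↥ r ℤ.* + n) (sym (ℕ.*-identityʳ (↧ₙ r)))))) ⟩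
    ↥ r / 1 ∎
    where open ≡-Reasoning

  cube-cancel-< : ∀ {p q} → cube p ℚ.< cube q → p ℚ.< q
  cube-cancel-< {p} {q} h with ℚ.<-cmp p q
  ... | tri< p<q _ _  = p<q
  ... | tri≈ _ refl _ = ⊥-elim (ℚ.<-irrefl refl h)
  ... | tri> _ _ q<p  = ⊥-elim (ℚ.<-asym h (Cube.mono q<p))

-- Dedekind cuts: bracketing the cube root of α by a rational.

L<U : ∀ (x : ℝ) {p q} → L x p → U x q → p ℚ.< q
L<U x {p} {q} Lp Uq with ℚ.<-cmp p q
... | tri< p<q _ _  = p<q
... | tri≈ _ refl _ = ⊥-elim (disjoint x Lp Uq)
... | tri> _ _ q<p  = ⊥-elim (disjoint x (L-down x q<p Lp) Uq)

open import Defs using (_<_; _≤_; _>_; _≥_)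

module CubeRootBracket (α : ℝ) where
  open import Data.Rational.Base using (_+_; _*_; _-_)
  open Rationals
  open +-*-Solver

  Bracket : ℚ → Set
  Bracket r = ℚ.Positive r × L α (cube r) × U α (+ 9 / 4 * cube r)

  -- The cube grows by (5/4)³ < 9/4 at each step; e bounds the increments of r below.
  search : ∀ (s e : ℚ) → 0ℚ ℚ.≤ e → U α (cube s) →
           ∀ fuel (r : ℚ) {{_ : ℚ.Positive r}} → + 4 / 1 * e ℚ.≤ r →
           s ℚ.≤ r + ι (+ fuel) * e → L α (cube r) → ∃ Bracket
  -- Without fuel the invariant reads s ≤ r, contradicting r³ < α < s³.
  search s e 0≤e Us zero r 4e≤r s≤ Lr = ⊥-elim (ℚ.<-irrefl refl (ℚ.<-≤-trans
    (cube-cancel-< {r} {s} (L<U α Lr Us))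
    (subst (s ℚ.≤_) (solve 2 (λ r e → r :+ con 0ℚ :* e := r) refl r e) s≤)))
  -- Locatedness of α between 125/64 r³ and 9/4 r³ either ends the search or justifies replacing r
  -- by 5r/4. Since 4e ≤ r, this adds at least e and pays for one unit of fuel.
  search s e 0≤e Us (suc fuel) r {{pos-r}} 4e≤r s≤ Lr
    with located α {+ 125 / 64 * cube r} {+ 9 / 4 * cube r}
           (ℚ.*-monoˡ-<-pos (cube r) {{pos-cube}} (from-yes (+ 125 / 64 ℚ.<? + 9 / 4)))
    where
    pos-cube : ℚ.Positive (cube r)
    pos-cube = ℚ.pos*pos⇒pos (r * r) {{ℚ.pos*pos⇒pos r r}} r
  ... | inj₂ Ur = r , pos-r , Lr , Ur
  ... | inj₁ Lr′ = search s e 0≤e Us fuel r′ {{ℚ.pos*pos⇒pos (+ 5 / 4) r}} (ℚ.≤-trans 4e≤r r≤r′) s≤′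
        (subst (L α) (solve 1 (λ r → con (+ 125 / 64) :* (r :* r :* r)
          := con (+ 5 / 4) :* r :* (con (+ 5 / 4) :* r) :* (con (+ 5 / 4) :* r)) refl r) Lr′)
    where
    r′ = + 5 / 4 * r
    r+e≤r′ : r + e ℚ.≤ r′
    r+e≤r′ = subst₂ ℚ._≤_
      (solve 2 (λ r e → r :+ con (+ 1 / 4) :* (con (+ 4 / 1) :* e) := r :+ e) refl r e)
      (solve 1 (λ r → r :+ con (+ 1 / 4) :* r := con (+ 5 / 4) :* r) refl r)
      (ℚ.+-monoʳ-≤ r (ℚ.*-monoˡ-≤-nonNeg (+ 1 / 4) 4e≤r))
    r≤r′ : r ℚ.≤ r′
    r≤r′ = ℚ.≤-trans (subst (ℚ._≤ r + e) (ℚ.+-identityʳ r) (ℚ.+-monoʳ-≤ r 0≤e)) r+e≤r′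
    s≤′ : s ℚ.≤ r′ + ι (+ fuel) * e
    s≤′ = ℚ.≤-trans s≤ (subst (ℚ._≤ r′ + ι (+ fuel) * e)
      (trans (solve 3 (λ r e f → r :+ e :+ f :* e := r :+ (con 1ℚ :+ f) :* e) refl r e (ι (+ fuel)))
        (cong (λ z → r + z * e) (sym (ι-+ 1ℤ (+ fuel)))))
      (ℚ.+-monoˡ-≤ (ι (+ fuel) * e) r+e≤r′))

  -- The search starts at a rational q with 0 < q < α: as q < 1, also q³ < α. With increment q/4 and
  -- fuel four times the denominator of q, the guaranteed growth is the numerator of q, at least 1,
  -- which reaches the upper end 1.
  bracket : fromℚ 0ℚ < α → α < fromℚ 1ℚ → ∃ Bracket
  bracket (q , 0<q , Lq) (s , Us , s<1) =
    search 1ℚ (+ 1 / 4 * q) (ℚ.nonNegative⁻¹ (+ 1 / 4 * q) {{ℚ.nonNeg*nonNeg⇒nonNeg (+ 1 / 4) q}})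
      U1 (4 ℕ.* ↧ₙ q) q
      (ℚ.≤-reflexive (solve 1 (λ q → con (+ 4 / 1) :* (con (+ 1 / 4) :* q) := q) refl q))
      (ℚ.≤-trans (subst (1ℚ ℚ.≤_) (sym fuel) (ι-mono-≤ (numerator-pos q)))
        (subst (ℚ._≤ q + f) (ℚ.+-identityˡ f) (ℚ.+-monoˡ-≤ f (ℚ.<⇒≤ 0<q))))
      (L-down α q³<q Lq)
    where
    instance
      q>0 : ℚ.Positive q
      q>0 = ℚ.positive 0<q
      q≥0 : ℚ.NonNegative q
      q≥0 = ℚ.pos⇒nonNeg q
      qq>0 : ℚ.Positive (q * q)
      qq>0 = ℚ.pos*pos⇒pos q q
    U1 : U α (cube 1ℚ)
    U1 = U-up α s<1 Us
    q<1 : q ℚ.< 1ℚ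
    q<1 = L<U α Lq U1
    q³<q : cube q ℚ.< q
    q³<q = ℚ.<-trans (subst (cube q ℚ.<_) (ℚ.*-identityʳ (q * q)) (ℚ.*-monoʳ-<-pos (q * q) q<1))
                     (subst (q * q ℚ.<_) (ℚ.*-identityʳ q) (ℚ.*-monoʳ-<-pos q q<1))
    f = ι (+ (4 ℕ.* ↧ₙ q)) * (+ 1 / 4 * q)
    fuel : f ≡ ι (↥ q)
    fuel = trans (cong (λ z → ι z * (+ 1 / 4 * q)) (ℤ.pos-* 4 (↧ₙ q)))
      (trans (cong (_* (+ 1 / 4 * q)) (ι-* (+ 4) (↧ q)))
      (trans (solve 2 (λ d q → con (+ 4 / 1) :* d :* (con (+ 1 / 4) :* q) := q :* d)
               refl (ι (↧ q)) q)
        (r*↧r q)))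
    numerator-pos : ∀ q {{_ : ℚ.Positive q}} → 1ℤ ℤ.≤ ↥ q
    numerator-pos (mkℚ (+ suc _) _ _) = +≤+ (ℕ.s≤s z≤n)

  -- r³ < α < 1/100000 < 1/15625 = (1/25)³.
  bracket<1/25 : α < fromℚ (+ 1 / 100000) → ∀ {r} → L α (cube r) → r ℚ.< + 1 / 25
  bracket<1/25 (s , Us , s<) {r} Lr = cube-cancel-< {r} (ℚ.<-trans (L<U α Lr (U-up α s< Us))
    (from-yes (+ 1 / 100000 ℚ.<? cube (+ 1 / 25))))

-- Real inequalities in α and integer inequalities in k and M.

module Translation (α : ℝ) {j : ℕ} (G : Graph (suc j)) (r : ℚ) (Lr : L α (cube r))
  (Ur : U α (+ 9 / 4 ℚ.* cube r)) (k M : ℕ) (0<M : 0ℤ ℤ.< + M)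
  (rM : r ℚ.* (+ M / 1) ≡ + k / 1) where
  open import Data.Rational.Base using (_+_; _*_; _-_)
  open Rationals
  open +-*-Solver
  open Sums
  private
    n = suc j
    module S₁ = Scale j
    -- `Scale` takes the predecessor of the factor, and `n ℕ.* n` reduces to the successor of this
    -- number.
    module S₂ = Scale (j ℕ.+ j ℕ.* suc j)

  0<c*M : ∀ c → 0ℤ ℤ.< + suc c ℤ.* + M
  0<c*M c = 0<* {+ suc c} (ℤ.+<+ ℕ.z<s) 0<M

  ι-linear : ∀ c → ι (+ n ℤ.* + M ℤ.- + c ℤ.* (+ k ℤ.* + n))
                   ≡ (ι (+ M) - ι (+ c) * (r * ι (+ M))) * ι (+ n)
  ι-linear c = trans (ι-- (+ n ℤ.* + M) _) (trans (cong₂ _-_ (ι-* (+ n) (+ M))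
      (trans (ι-* (+ c) _)
        (cong (ι (+ c) *_) (trans (ι-* (+ k) (+ n)) (cong (_* ι (+ n)) (sym rM))))))
    (solve 4 (λ c r y n → n :* y :- c :* (r :* y :* n) := (y :- c :* (r :* y)) :* n)
      refl (ι (+ c)) r (ι (+ M)) (ι (+ n))))

  -- Since α < 9/4 r³, the rational (1/4 - 9/4 r³) n² lies in the lower cut of (1/4 - α) n², hence
  -- below m. Multiplying by 4M³ clears denominators.
  dense : fromℕ (∣E∣ G) ≥ (n ℕ.* n) ⋆ (+ 1 / 4 ⊖ α) →
          0ℤ ℤ.≤ + 4 ℤ.* + ∣E∣ G ℤ.* (+ M ℤ.* + M ℤ.* + M)
               ℤ.+ + 9 ℤ.* (+ k ℤ.* + k ℤ.* + k) ℤ.* (+ n ℤ.* + n)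
               ℤ.- + n ℤ.* + n ℤ.* (+ M ℤ.* + M ℤ.* + M)
  dense H = subst (0ℤ ℤ.≤_) (trans (polynomial (+ (n ℕ.* n)) (+ M) (+ k) (+ ∣E∣ G))
      (cong (λ N → + 4 ℤ.* + ∣E∣ G ℤ.* M³ ℤ.+ + 9 ℤ.* k³ ℤ.* N ℤ.- N ℤ.* M³) (ℤ.pos-* n n)))
      (ℤ.i≤j⇒0≤j-i (ℤ.<⇒≤
      (numerators-<⁻ A (+ ∣E∣ G ℤ.* D) 0<D qD mD (H q (subst (U α) (sym unscale) Ur)))))
    where
    M³ = + M ℤ.* + M ℤ.* + M
    k³ = + k ℤ.* + k ℤ.* + k
    D = + 4 ℤ.* M³
    w = + 9 / 4 * cube r
    q = (+ 1 / 4 - w) * ι (+ (n ℕ.* n))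
    0<D : 0ℤ ℤ.< D
    0<D = 0<* {+ 4} (ℤ.+<+ ℕ.z<s) (0<* {+ M ℤ.* + M} (0<* 0<M 0<M) 0<M)
    unscale : + 1 / 4 - q * S₂.1/K ≡ w
    unscale = trans (cong (ℚ._-_ (+ 1 / 4)) (S₂.f[p*K] (+ 1 / 4 - w))) (p-[p-q] (+ 1 / 4) w)
    ι³ : ∀ i → ι (i ℤ.* i ℤ.* i) ≡ cube (ι i)
    ι³ i = trans (ι-* (i ℤ.* i) i) (cong (_* ι i) (ι-* i i))
    A = (M³ ℤ.- + 9 ℤ.* k³) ℤ.* + (n ℕ.* n)
    qD : q * ι D ≡ ι A
    qD = trans (cong (q *_) (trans (ι-* (+ 4) M³) (cong (ι (+ 4) *_) (ι³ (+ M)))))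
      (trans (solve 3 (λ r y z → (con (+ 1 / 4) :- con (+ 9 / 4) :* (r :* r :* r)) :* z
                   :* (con (+ 4 / 1) :* (y :* y :* y))
                 := (y :* y :* y :- con (+ 9 / 1) :* (r :* y :* (r :* y) :* (r :* y))) :* z)
               refl r (ι (+ M)) (ι (+ (n ℕ.* n))))
      (sym (trans (ι-* (M³ ℤ.- + 9 ℤ.* k³) (+ (n ℕ.* n))) (cong (_* ι (+ (n ℕ.* n)))
        (trans (ι-- M³ (+ 9 ℤ.* k³)) (cong₂ _-_ (ι³ (+ M))
          (trans (ι-* (+ 9) k³) (cong (ι (+ 9) *_) (trans (ι³ (+ k)) (cong cube (sym rM)))))))))))
    mD : ι (+ ∣E∣ G) * ι D ≡ ι (+ ∣E∣ G ℤ.* D)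
    mD = sym (ι-* (+ ∣E∣ G) D)
    polynomial : ∀ N M k m →
      m ℤ.* (+ 4 ℤ.* (M ℤ.* M ℤ.* M)) ℤ.- (M ℤ.* M ℤ.* M ℤ.- + 9 ℤ.* (k ℤ.* k ℤ.* k)) ℤ.* N
      ≡ + 4 ℤ.* m ℤ.* (M ℤ.* M ℤ.* M) ℤ.+ + 9 ℤ.* (k ℤ.* k ℤ.* k) ℤ.* N ℤ.- N ℤ.* (M ℤ.* M ℤ.* M)
    polynomial = solve-∀

  -- The rational (1/6 - 2r) n separates the two sides: it exceeds (1/6 - 2α^(1/3)) n because r³ <
  -- α, and lies below the booksize by the negated inequality.
  books : ¬ (0ℤ ℤ.≤ + n ℤ.* + M ℤ.- (+ 6 ℤ.* (+ bk G ℤ.* + M) ℤ.+ + 12 ℤ.* (+ k ℤ.* + n))) →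
          fromℕ (bk G) > n ⋆ (+ 1 / 6 ⊖ 2 ⋆ ∛ α)
  books neg = q , subst (L α) (sym (cong cube unscale)) Lr , numerators-<
      (+ n ℤ.* + M ℤ.- + 12 ℤ.* (+ k ℤ.* + n)) (+ bk G ℤ.* (+ 6 ℤ.* + M)) (0<c*M 5) qD bD
      (ℤ.≰⇒> λ B≤A → neg (subst (0ℤ ℤ.≤_) (identity (+ n) (+ M) (+ bk G) (+ k)) (ℤ.i≤j⇒0≤j-i B≤A)))
    where
    q = (+ 1 / 6 - + 2 / 1 * r) * ι (+ n)
    unscale : (+ 1 / 6 - q * S₁.1/K) * Scale.1/K 1 ≡ r
    unscale = trans (cong (λ z → (+ 1 / 6 - z) * Scale.1/K 1) (S₁.f[p*K] (+ 1 / 6 - + 2 / 1 * r)))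
      (solve 1 (λ r → (con (+ 1 / 6) :- (con (+ 1 / 6) :- con (+ 2 / 1) :* r)) :* con (+ 1 / 2) := r)
        refl r)
    qD : q * ι (+ 6 ℤ.* + M) ≡ ι (+ n ℤ.* + M ℤ.- + 12 ℤ.* (+ k ℤ.* + n))
    qD = trans (cong (q *_) (ι-* (+ 6) (+ M))) (trans
      (solve 3 (λ r n y → (con (+ 1 / 6) :- con (+ 2 / 1) :* r) :* n :* (con (+ 6 / 1) :* y)
        := (y :- con (+ 12 / 1) :* (r :* y)) :* n) refl r (ι (+ n)) (ι (+ M)))
      (sym (ι-linear 12)))
    bD : ι (+ bk G) * ι (+ 6 ℤ.* + M) ≡ ι (+ bk G ℤ.* (+ 6 ℤ.* + M))
    bD = sym (ι-* (+ bk G) _)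
    identity : ∀ n M b k → n ℤ.* M ℤ.- + 12 ℤ.* (k ℤ.* n) ℤ.- b ℤ.* (+ 6 ℤ.* M)
                           ≡ n ℤ.* M ℤ.- (+ 6 ℤ.* (b ℤ.* M) ℤ.+ + 12 ℤ.* (k ℤ.* n))
    identity = solve-∀

  -- If q is in the lower cut of n(p - y), then p - q/n lies above y and so above every x below y.
  -- Solving for q gives q < (p - x) n.
  below : ∀ p {x q s} → x ℚ.< p - q * S₁.1/K → (p - x) * ι (+ n) ℚ.≤ s → q ℚ.< s
  below p {x} {q} {s} x< bound = ℚ.<-≤-trans
    (subst (ℚ._< (p - x) * ι (+ n)) (S₁.f[p]*K q)
      (ℚ.*-monoˡ-<-pos S₁.K
        (subst (ℚ._< p - x) (p-[p-q] p (q * S₁.1/K)) (-ʳ-anti p x<))))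
    bound

  r< : ∀ q → U (∛ α) q → r ℚ.< q
  r< q Uq = cube-cancel-< {r} (L<U α Lr Uq)

  size : ∀ s → 0ℤ ℤ.≤ + k ℤ.* + n ℤ.- + M ℤ.* (+ n ℤ.- + s) → fromℕ s ≥ n ⋆ (+ 1 / 1 ⊖ ∛ α)
  size s h q Uq = below 1ℚ (r< _ Uq) (numerators-≤
      (+ n ℤ.* + M ℤ.- + 1 ℤ.* (+ k ℤ.* + n)) (+ s ℤ.* + M) 0<M pD (sym (ι-* (+ s) (+ M)))
      (ℤ.0≤i-j⇒j≤i (subst (0ℤ ℤ.≤_) (identity (+ n) (+ M) (+ k) (+ s)) h)))
    where
    pD : (1ℚ - r) * ι (+ n) * ι (+ M) ≡ ι (+ n ℤ.* + M ℤ.- + 1 ℤ.* (+ k ℤ.* + n))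
    pD = trans (solve 3 (λ r n y → (con 1ℚ :- r) :* n :* y := (y :- con 1ℚ :* (r :* y)) :* n)
                  refl r (ι (+ n)) (ι (+ M)))
               (sym (ι-linear 1))
    identity : ∀ n M k s → k ℤ.* n ℤ.- M ℤ.* (n ℤ.- s) ≡ s ℤ.* M ℤ.- (n ℤ.* M ℤ.- + 1 ℤ.* (k ℤ.* n))
    identity = solve-∀

  min-degree : ∀ e → 0ℤ ℤ.≤ + 2 ℤ.* (+ e ℤ.* + M) ℤ.+ + 5 ℤ.* (+ k ℤ.* + n) ℤ.- + n ℤ.* + M →
               fromℕ e ≥ n ⋆ (+ 1 / 2 ⊖ 4 ⋆ ∛ α)
  min-degree e h q Uq = below (+ 1 / 2) 4r< (numerators-≤
      (+ n ℤ.* + M ℤ.- + 8 ℤ.* (+ k ℤ.* + n)) (+ e ℤ.* (+ 2 ℤ.* + M)) (0<c*M 1) pD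
        (sym (ι-* (+ e) (+ 2 ℤ.* + M)))
      (ℤ.0≤i-j⇒j≤i (subst (0ℤ ℤ.≤_) (identity (+ n) (+ M) (+ k) (+ e))
        -- The available bound has 5r/2 and the claim allows 4r = 8r/2; the difference, scaled by
        -- 2M, is this 3kn.
        (0≤+ h (0≤* {+ 3} {+ k ℤ.* + n} 0≤+n (0≤* {+ k} {+ n} 0≤+n 0≤+n))))))
    where
    4r< : r * (+ 4 / 1) ℚ.< + 1 / 2 - q * S₁.1/K
    4r< = subst (r * (+ 4 / 1) ℚ.<_) (Scale.f[p]*K 3 (+ 1 / 2 - q * S₁.1/K))
      (ℚ.*-monoˡ-<-pos (+ 4 / 1) (r< ((+ 1 / 2 - q * S₁.1/K) * Scale.1/K 3) Uq))
    pD : (+ 1 / 2 - r * (+ 4 / 1)) * ι (+ n) * ι (+ 2 ℤ.* + M)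
         ≡ ι (+ n ℤ.* + M ℤ.- + 8 ℤ.* (+ k ℤ.* + n))
    pD = trans (cong ((+ 1 / 2 - r * (+ 4 / 1)) * ι (+ n) *_) (ι-* (+ 2) (+ M))) (trans
      (solve 3 (λ r n y → (con (+ 1 / 2) :- r :* con (+ 4 / 1)) :* n :* (con (+ 2 / 1) :* y)
        := (y :- con (+ 8 / 1) :* (r :* y)) :* n) refl r (ι (+ n)) (ι (+ M)))
      (sym (ι-linear 8)))
    identity : ∀ n M k e → + 2 ℤ.* (e ℤ.* M) ℤ.+ + 5 ℤ.* (k ℤ.* n) ℤ.- n ℤ.* M ℤ.+ + 3 ℤ.* (k ℤ.* n)
                           ≡ e ℤ.* (+ 2 ℤ.* M) ℤ.- (n ℤ.* M ℤ.- + 8 ℤ.* (k ℤ.* n))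
    identity = solve-∀

-- Assembly: the case distinction on the booksize.

open import Data.Nat.Base using (_*_)

module _ (α : ℝ) {j : ℕ} (G : Graph (suc j)) where
  private
    n = suc j

  Conclusion : Set
  Conclusion =
    fromℕ (bk G) > n ⋆ (+ 1 / 6 ⊖ 2 ⋆ ∛ α)
    ⊎ (∃ λ (S : Subset n) →
    Bipartite G S
    × fromℕ ∣ S ∣ ≥ n ⋆ (+ 1 / 1 ⊖ ∛ α)
    × fromℕ (δ G S) ≥ n ⋆ (+ 1 / 2 ⊖ 4 ⋆ ∛ α))

  bracketed : ∀ r k M → L α (cube r) → U α (+ 9 / 4 ℚ.* cube r) →
    0ℤ ℤ.< + k → 0ℤ ℤ.< + M → 0ℤ ℤ.< + M ℤ.- + 25 ℤ.* + k →
    r ℚ.* (+ M / 1) ≡ + k / 1 →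
    fromℕ (∣E∣ G) ≥ (n * n) ⋆ (+ 1 / 4 ⊖ α) → Conclusion
  -- The booksize is compared with the rational (1/6 - 2r) n, an integer comparison and hence
  -- decidable, unlike one with the real bound.
  bracketed r k M Lr Ur 0<k 0<M 25k<M rM H = decide
      (0ℤ ℤ.≤? + n ℤ.* + M ℤ.- (+ 6 ℤ.* (+ bk G ℤ.* + M) ℤ.+ + 12 ℤ.* (+ k ℤ.* + n)))
    where
    module T = Translation α G r Lr Ur k M 0<M rM
    module C = Core G k M
    0<n : 0ℤ ℤ.< + n
    0<n = ℤ.+<+ ℕ.z<s
    decide : Dec (0ℤ ℤ.≤ + n ℤ.* + M ℤ.- (+ 6 ℤ.* (+ bk G ℤ.* + M) ℤ.+ + 12 ℤ.* (+ k ℤ.* + n)))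
             → Conclusion
    decide (no large-book)   = inj₁ (T.books large-book)
    decide (yes small-books) = inj₂
      (C.S , S-bipartite , T.size ∣ C.S ∣ size , T.min-degree (δ G C.S) min-degree)
      where open C.Dense 0<n 0<k 25k<M (T.dense H) small-books

theorem6 : ∀ (α : ℝ) → fromℚ 0ℚ < α → α < fromℚ (+ 1 / 100000) →
    ∀ (n m : ℕ) (G : Graph n) → ∣E∣ G ≡ m →
    fromℕ m ≥ (n * n) ⋆ (+ 1 / 4 ⊖ α) →
    fromℕ (bk G) > n ⋆ (+ 1 / 6 ⊖ 2 ⋆ ∛ α)
    ⊎ (∃ λ (S : Subset n) →
    Bipartite G S
    × fromℕ ∣ S ∣ ≥ n ⋆ (+ 1 / 1 ⊖ ∛ α)
    × fromℕ (δ G S) ≥ n ⋆ (+ 1 / 2 ⊖ 4 ⋆ ∛ α))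
theorem6 α 0<α α<ε zero m G _ _ =
  -- For n = 0 the empty set works: its size, its minimum degree and both bounds are 0.
  inj₂ ([] , ([] , [] , refl , (λ ()) , (λ {}) , (λ {})) , (λ _ h → h) , (λ _ h → h))
theorem6 α 0<α α<ε (suc j) _ G refl H = conclude (bracket 0<α α<1)
  where
  open CubeRootBracket α
  α<1 : α < fromℚ 1ℚ
  α<1 = let s , Us , s<ε = α<ε in s , Us , ℚ.<-trans s<ε (from-yes (+ 1 / 100000 ℚ.<? 1ℚ))
  conclude : ∃ Bracket → Conclusion α G
  -- The numerator and denominator of r serve as k and M; positivity of r leaves only positive
  -- numerators.
  conclude (r@(mkℚ (+ k@(suc _)) M-1 _) , _ , Lr , Ur) =
    bracketed α G r k (suc M-1) Lr Ur (ℤ.+<+ ℕ.z<s) (ℤ.+<+ ℕ.z<s)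
      (25k<M (bracket<1/25 α<ε {r} Lr)) (Rationals.r*↧r r) H
    where
    25k<M : r ℚ.< + 1 / 25 → 0ℤ ℤ.< + suc M-1 ℤ.- + 25 ℤ.* + k
    25k<M (ℚ.*<* h) = subst₂ ℤ._<_ (ℤ.+-inverseʳ (+ 25 ℤ.* + k))
      (cong (ℤ._- + 25 ℤ.* + k) (ℤ.*-identityˡ (+ suc M-1)))
      (ℤ.+-monoˡ-< (ℤ.- (+ 25 ℤ.* + k)) (subst (ℤ._< 1ℤ ℤ.* + suc M-1) (ℤ.*-comm (+ k) (+ 25)) h))
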